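{- Let $\Gamma$, the new edge $\mathcal{E}$ and the spine $\mathcal{S}=\Gamma+\mathcal{E}$ be as specified in the context, and assume $h(-p)>\mathrm{ord}(\ell)$. Then $$\frac{h(-p)\,\mathrm{ord}(\ell)+3h(-p)+6\,\mathrm{ord}(\ell)}{2(h(-p)-\mathrm{ord}(\ell))}\ >\ \frac12\left(\mathrm{ord}(\ell)+3-\frac{4\,\mathrm{ord}(\ell)}{h(-p)+\mathrm{ord}(\ell)}\right).$$ If edge attachment occurs (the endpoints of $\mathcal{E}$ lie in different connected components of $\Gamma$), then $\mathrm{MeanDiam}(\mathcal{S})$ is at least the left-hand side; if edge attachment does not occur, then $\mathrm{MeanDiam}(\mathcal{S})$ is at most the right-hand side. Consequently, given $h(-p)$ and $\mathrm{ord}(\ell)$, the value of $\mathrm{MeanDiam}(\mathcal{S})$ determines whether edge attachment occurs.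
   Context: Let $p$ be a prime with $p\equiv 71$ or $119\pmod{120}$ and $\ell=2$. Let $h(-p)$ be the class number of $\mathbb{Q}(\sqrt{ -p})$ (it is odd) and let $L=\mathrm{ord}(\ell)$ be the order in the class group of a prime ideal above $2$; $L$ is an odd integer $\ge3$ dividing $h(-p)$. The graph $\Gamma$ (the supersingular $2$-isogeny graph over $\mathbb{F}_p$ after identifying curves and isogenies up to $\overline{\mathbb{F}_p}$-equivalence, regarded as a simple undirected graph) is the disjoint union of one folded component $\mathcal{F}$ and $\frac12\left(\frac{h(-p)}{L}-1\right)$ stacked components, each a copy of $\mathcal{T}$, where $V(\mathcal{F})=\{0,\dots,L-1\}$, $E(\mathcal{F})=\{\{2k-1,2k+1\}: 1\le k\le \tfrac12(L-3)\}\cup\{\{2k+1,2k+2\}:0\le k\le \tfrac12(L-3)\}\cup\{\{0,1\}\}$, and $V(\mathcal{T})=\{0,\dots,2L-1\}$, $E(\mathcal{T})=\{\{2i,2i+1\}:0\le i\le L-1\}\cup\{\{2i+1,2i+3\}:0\le i\le L-2\}\cup\{\{2L-1,1\}\}$. Floor vertices are the nonzero even vertices of $\mathcal{F}$ and all even vertices of the stacked components. The spine $\mathcal{S}$ is obtained from $\Gamma$ by adding a single new edge $\mathcal{E}$ (coming from $2$-isogenies not defined over $\mathbb{F}_p$), whose endpoints are two distinct floor vertices; it is treated here as an arbitrary such edge. For a graph with connected components $C_1,\dots,C_m$, $\mathrm{MeanDiam}$ is $\frac1m\sum_{i=1}^m\mathrm{diam}(C_i)$. -}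

module Defs where

open import Data.Fin using (Fin; zero; suc; toℕ)
import Data.Fin.Properties as Fin
open import Data.Integer as ℤ using (ℤ; +_)
open import Data.List
  using (List; []; _∷_; _++_; map; filter; deduplicate; length; lookup;
         allFin; cartesianProduct; cartesianProductWith)
open import Data.List.Extrema.Nat using (max)
open import Data.List.Membership.Propositional using (_∈_; lose; find)
open import Data.List.Membership.Propositional.Properties
  using (∈-++⁺ˡ; ∈-++⁺ʳ; ∈-map⁺; ∈-allFin; ∈-cartesianProduct⁺)
open import Data.List.Relation.Unary.Any as Any using (Any; any?; index)
open import Data.List.Relation.Unary.Any.Properties using (lookup-index)
open import Data.Nat
  using (ℕ; zero; suc; _+_; _*_; _∸_; _/_; _≤_; _<_; _≤?_; _<?_; z<s; s≤s⁻¹;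
         NonZero; >-nonZero; >-nonZero⁻¹)
open import Data.Nat.Divisibility using (_∣_)
open import Data.Nat.Induction using (<-rec)
open import Data.Nat.ListAction using (sum)
import Data.Nat.Properties as ℕ
open import Data.Product using (Σ; ∃-syntax; _×_; _,_; proj₁; proj₂)
open import Data.Product.Properties using (≡-dec)
open import Data.Rational as ℚ using (ℚ; 0ℚ; ½)
open import Data.Sum as Sum using (_⊎_; inj₁; inj₂)
import Data.Sum.Properties as Sum
open import Function using (_∘_; _⇔_)
open import Level using (0ℓ)
open import Relation.Binary using (Rel; Decidable; DecidableEquality; Symmetric; Irreflexive)
open import Relation.Binary.PropositionalEquality
  using (_≡_; _≢_; refl; sym; trans; cong; subst)
open import Relation.Nullary using (¬_; Dec; yes; no; ¬?; _×-dec_; _⊎-dec_; contradiction)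
open import Relation.Nullary.Decidable using (map′)
import Relation.Unary as Unary

------------------------------------------------------------------------
-- The class group of ℚ(√-p)

-- For p ≡ 3 (mod 4) the ring of integers of ℚ(√-p) is ℤ[ω] with
-- ω = (1 + √-p)/2, so that ω² = ω - (p + 1)/4.
record 𝓞 (p : ℕ) : Set where
  constructor _+_ω
  field
    re im : ℤ

module QuadraticOrder (p : ℕ) where

  infixl 6 _⊕_
  infixl 7 _⊗_ _·_

  norm-ω : ℤ
  norm-ω = + (suc p / 4)

  embed : ℤ → 𝓞 p
  embed n = n + (+ 0) ω

  _⊕_ _⊗_ : 𝓞 p → 𝓞 p → 𝓞 p
  (a + b ω) ⊕ (c + d ω) = (a ℤ.+ c) + (b ℤ.+ d) ω
  (a + b ω) ⊗ (c + d ω) =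
    (a ℤ.* c ℤ.- norm-ω ℤ.* (b ℤ.* d)) + (a ℤ.* d ℤ.+ b ℤ.* c ℤ.+ b ℤ.* d) ω

  0𝓞 1𝓞 : 𝓞 p
  0𝓞 = embed (+ 0)
  1𝓞 = embed (+ 1)

  -- ℤ[ω] is Noetherian, so its ideals are given by finite lists of generators.
  Ideal : Set
  Ideal = List (𝓞 p)

  data _∈ᴵ_ : 𝓞 p → Ideal → Set where
    zero : ∀ {I} → 0𝓞 ∈ᴵ I
    step : ∀ {I g x} r → g ∈ I → x ∈ᴵ I → (r ⊗ g ⊕ x) ∈ᴵ I

  NonZeroIdeal : Ideal → Set
  NonZeroIdeal = Any (_≢ 0𝓞)

  _·_ : 𝓞 p → Ideal → Ideal
  α · I = map (α ⊗_) I

  _*ᴵ_ : Ideal → Ideal → Ideal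
  _*ᴵ_ = cartesianProductWith _⊗_

  _^ᴵ_ : Ideal → ℕ → Ideal
  I ^ᴵ zero  = 1𝓞 ∷ []
  I ^ᴵ suc n = I *ᴵ (I ^ᴵ n)

  _≈ᴵ_ : Ideal → Ideal → Set
  I ≈ᴵ J = ∀ x → x ∈ᴵ I ⇔ x ∈ᴵ J

  -- Equality of ideal classes.
  _∼_ : Ideal → Ideal → Set
  I ∼ J = ∃[ α ] ∃[ β ] α ≢ 0𝓞 × β ≢ 0𝓞 × (α · I) ≈ᴵ (β · J)

  IsPrimeIdeal : Ideal → Set
  IsPrimeIdeal I =
    ¬ (1𝓞 ∈ᴵ I) × (∀ x y → (x ⊗ y) ∈ᴵ I → x ∈ᴵ I ⊎ y ∈ᴵ I)

  IsClassNumber : ℕ → Set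
  IsClassNumber h = Σ (Fin h → Ideal) λ rep →
      (∀ i → NonZeroIdeal (rep i))
    × (∀ i j → rep i ∼ rep j → i ≡ j)
    × (∀ I → NonZeroIdeal I → ∃[ i ] I ∼ rep i)

  IsPrimeAbove2 : Ideal → Set
  IsPrimeAbove2 I = IsPrimeIdeal I × embed (+ 2) ∈ᴵ I

  IsClassOrder : Ideal → ℕ → Set
  IsClassOrder I L =
    0 < L × (I ^ᴵ L) ∼ (1𝓞 ∷ []) × (∀ k → 0 < k → (I ^ᴵ k) ∼ (1𝓞 ∷ []) → L ≤ k)

open QuadraticOrder public
  using (Ideal; IsClassNumber; IsPrimeAbove2; IsClassOrder)

------------------------------------------------------------------------
-- Finite simple graphs and their mean diameter

record FiniteGraph : Set₁ where
  field
    Vertex   : Set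
    _≟_      : DecidableEquality Vertex
    vertices : List Vertex
    complete : ∀ v → v ∈ vertices
    Adj      : Rel Vertex 0ℓ
    adj?     : Decidable Adj
    symm     : Symmetric Adj
    irrefl   : Irreflexive _≡_ Adj

-- The simple graph with edges {x , y} for E x y; a pair E x x yields no edge.
fromEdges : (V : Set) → DecidableEquality V →
            (vs : List V) → (∀ v → v ∈ vs) →
            (E : Rel V 0ℓ) → Decidable E → FiniteGraph
fromEdges V _≟_ vs complete E E? = record
  { Vertex   = V
  ; _≟_      = _≟_
  ; vertices = vs
  ; complete = complete
  ; Adj      = λ x y → x ≢ y × (E x y ⊎ E y x)
  ; adj?     = λ x y → ¬? (x ≟ y) ×-dec (E? x y ⊎-dec E? y x)
  ; symm     = λ (x≢y , e) → x≢y ∘ sym , Sum.swap e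
  ; irrefl   = λ x≡y (x≢y , _) → x≢y x≡y
  }

addEdge : (G : FiniteGraph) (u v : FiniteGraph.Vertex G) → u ≢ v → FiniteGraph
addEdge G u v u≢v = record
  { Vertex   = Vertex
  ; _≟_      = _≟_
  ; vertices = vertices
  ; complete = complete
  ; Adj      = λ x y → Adj x y ⊎ Joins x y
  ; adj?     = λ x y → adj? x y ⊎-dec
                 ((x ≟ u ×-dec y ≟ v) ⊎-dec (x ≟ v ×-dec y ≟ u))
  ; symm     = Sum.map symm λ where
                 (inj₁ (p , q)) → inj₂ (q , p)
                 (inj₂ (p , q)) → inj₁ (q , p)
  ; irrefl   = λ where
                 x≡y  (inj₁ a)                    → irrefl x≡y a
                 refl (inj₂ (inj₁ (refl , u≡v))) → u≢v u≡v
                 refl (inj₂ (inj₂ (refl , v≡u))) → u≢v (sym v≡u)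
  }
  where
  open FiniteGraph G
  Joins : Rel Vertex 0ℓ
  Joins x y = (x ≡ u × y ≡ v) ⊎ (x ≡ v × y ≡ u)

least : ∀ {P : ℕ → Set} → Unary.Decidable P → ∀ n → P n →
        ∃[ m ] P m × (∀ k → P k → m ≤ k)
least P? zero    p = zero , p , λ _ _ → _≤_.z≤n
least P? (suc n) p with P? zero
... | yes p₀ = zero , p₀ , λ _ _ → _≤_.z≤n
... | no ¬p₀ with least (P? ∘ suc) n p
...   | m , pm , min = suc m , pm , λ where
          zero    pk → contradiction pk ¬p₀
          (suc k) pk → _≤_.s≤s (min k pk)

mean : List ℕ → ℚ
mean []          = 0ℚ
mean xs@(_ ∷ _) = (+ sum xs) ℚ./ length xs

module _ (G : FiniteGraph) where
  open FiniteGraph G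

  data Walk : ℕ → Vertex → Vertex → Set where
    []  : ∀ {u} → Walk 0 u u
    _∷_ : ∀ {n u v w} → Adj u v → Walk n v w → Walk (suc n) u w

  Connected : Rel Vertex 0ℓ
  Connected u v = ∃[ n ] Walk n u v

  walk? : ∀ n u v → Dec (Walk n u v)
  walk? zero u v = map′ (λ { refl → [] }) (λ { [] → refl }) (u ≟ v)
  walk? (suc n) u w = map′ to from (any? (λ v → adj? u v ×-dec walk? n v w) vertices)
    where
    to : Any (λ v → Adj u v × Walk n v w) vertices → Walk (suc n) u w
    to a with find a
    ... | _ , _ , e , p = e ∷ p
    from : Walk (suc n) u w → Any (λ v → Adj u v × Walk n v w) vertices
    from (e ∷ p) = lose (complete _) (e , p)

  private
    _++ʷ_ : ∀ {m n u v w} → Walk m u v → Walk n v w → Walk (m + n) u w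
    []      ++ʷ q = q
    (e ∷ p) ++ʷ q = e ∷ (p ++ʷ q)

    visit : ∀ {n u v} → Walk n u v → Fin (suc n) → Vertex
    visit {u = u} _       zero    = u
    visit         (_ ∷ p) (suc i) = visit p i

    before : ∀ {n u v} (p : Walk n u v) i → Walk (toℕ i) u (visit p i)
    before _       zero    = []
    before (e ∷ p) (suc i) = e ∷ before p i

    after : ∀ {n u v} (p : Walk n u v) i → Walk (n ∸ toℕ i) (visit p i) v
    after p       zero    = p
    after (e ∷ p) (suc i) = after p i

    index-injective : ∀ {x y} → index (complete x) ≡ index (complete y) → x ≡ y
    index-injective {x} {y} eq =
      trans (lookup-index (complete x))
        (trans (cong (lookup vertices) eq) (sym (lookup-index (complete y))))

    cut-shorter : ∀ n i j → i < j → j ≤ n → i + (n ∸ j) < n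
    cut-shorter n i j i<j j≤n =
      subst (i + (n ∸ j) <_) (ℕ.m+[n∸m]≡n j≤n) (ℕ.+-monoˡ-< (n ∸ j) i<j)

    shorten : ∀ {n u v} → length vertices ≤ n → Walk n u v →
              ∃[ m ] m < n × Walk m u v
    shorten {n} {u} {v} N≤n p
      with Fin.pigeonhole (_≤_.s≤s N≤n) (λ i → index (complete (visit p i)))
    ... | i , j , i<j , eq =
      toℕ i + (n ∸ toℕ j) ,
      cut-shorter n (toℕ i) (toℕ j) i<j (s≤s⁻¹ (Fin.toℕ<n j)) ,
      before p i ++ʷ
        subst (λ x → Walk (n ∸ toℕ j) x v) (sym (index-injective eq)) (after p j)

    bounded : ∀ {u v} n → Walk n u v → ∃[ m ] m < length vertices × Walk m u v
    bounded {u} {v} = <-rec P go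
      where
      P : ℕ → Set
      P n = Walk n u v → ∃[ m ] m < length vertices × Walk m u v
      go : ∀ n → (∀ {m} → m < n → P m) → P n
      go n rec p with n <? length vertices
      ... | yes n<N = n , n<N , p
      ... | no  n≮N with shorten (ℕ.≮⇒≥ n≮N) p
      ...   | m , m<n , q = rec m<n q

  connected? : Decidable Connected
  connected? u v =
    map′ (λ (n , _ , p) → n , p) (λ (n , p) → bounded n p)
      (ℕ.anyUpTo? (λ n → walk? n u v) (length vertices))

  -- The length of a shortest walk; 0 if there is none.
  dist : Vertex → Vertex → ℕ
  dist u v with connected? u v
  ... | yes (n , p) = proj₁ (least (λ k → walk? k u v) n p)
  ... | no  _       = 0

  component : Vertex → List Vertex
  component v = filter (connected? v) vertices

  components : List (List Vertex)
  components = map component (deduplicate connected? vertices)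

  -- Distances are taken in G; on a connected component they agree with those
  -- of the induced subgraph.
  diam : List Vertex → ℕ
  diam C = max 0 (cartesianProductWith dist C C)

  meanDiam : ℚ
  meanDiam = mean (map diam components)

------------------------------------------------------------------------
-- The graph Γ and the spine

-- The bound 2k + 3 ≤ L says k ≤ (L - 3)/2.
data FoldedEdge (L : ℕ) : Rel ℕ 0ℓ where
  path : ∀ k → 1 ≤ k → 2 * k + 3 ≤ L → FoldedEdge L (2 * k ∸ 1) (2 * k + 1)
  leaf : ∀ k → 2 * k + 3 ≤ L → FoldedEdge L (2 * k + 1) (2 * k + 2)
  base : FoldedEdge L 0 1

data StackedEdge (L : ℕ) : Rel ℕ 0ℓ where
  leaf  : ∀ i → i < L → StackedEdge L (2 * i) (2 * i + 1)
  cycle : ∀ i → suc i < L → StackedEdge L (2 * i + 1) (2 * i + 3)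
  close : StackedEdge L (2 * L ∸ 1) 1

private
  below : ∀ {k L} → 2 * k + 3 ≤ L → k < L
  below {k} h = ℕ.<-≤-trans
    (ℕ.<-≤-trans (ℕ.m<m+n k (z<s {n = 2})) (ℕ.+-monoˡ-≤ 3 (ℕ.m≤m+n k _))) h

foldedEdge? : ∀ L → Decidable (FoldedEdge L)
foldedEdge? L a b = map′ to from (path? ⊎-dec leaf? ⊎-dec base?)
  where
  Path Leaf : ℕ → Set
  Path k = (1 ≤ k × 2 * k + 3 ≤ L) × a ≡ 2 * k ∸ 1 × b ≡ 2 * k + 1
  Leaf k = 2 * k + 3 ≤ L × a ≡ 2 * k + 1 × b ≡ 2 * k + 2
  Cases : Set
  Cases = (∃[ k ] k < L × Path k) ⊎ (∃[ k ] k < L × Leaf k) ⊎ (a ≡ 0 × b ≡ 1)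
  path? : Dec (∃[ k ] k < L × Path k)
  path? = ℕ.anyUpTo? (λ k → (1 ≤? k ×-dec 2 * k + 3 ≤? L) ×-dec
                             a ℕ.≟ 2 * k ∸ 1 ×-dec b ℕ.≟ 2 * k + 1) L
  leaf? : Dec (∃[ k ] k < L × Leaf k)
  leaf? = ℕ.anyUpTo? (λ k → 2 * k + 3 ≤? L ×-dec
                             a ℕ.≟ 2 * k + 1 ×-dec b ℕ.≟ 2 * k + 2) L
  base? : Dec (a ≡ 0 × b ≡ 1)
  base? = a ℕ.≟ 0 ×-dec b ℕ.≟ 1
  to : Cases → FoldedEdge L a b
  to (inj₁ (k , _ , (p , q) , refl , refl))  = path k p q
  to (inj₂ (inj₁ (k , _ , q , refl , refl))) = leaf k q
  to (inj₂ (inj₂ (refl , refl)))             = base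
  from : FoldedEdge L a b → Cases
  from (path k p q) = inj₁ (k , below q , (p , q) , refl , refl)
  from (leaf k q)   = inj₂ (inj₁ (k , below q , q , refl , refl))
  from base         = inj₂ (inj₂ (refl , refl))

stackedEdge? : ∀ L → Decidable (StackedEdge L)
stackedEdge? L a b = map′ to from (leaf? ⊎-dec cycle? ⊎-dec close?)
  where
  Leaf Cycle : ℕ → Set
  Leaf  i = a ≡ 2 * i × b ≡ 2 * i + 1
  Cycle i = suc i < L × a ≡ 2 * i + 1 × b ≡ 2 * i + 3
  Cases : Set
  Cases = (∃[ i ] i < L × Leaf i) ⊎ (∃[ i ] i < L × Cycle i) ⊎ (a ≡ 2 * L ∸ 1 × b ≡ 1)
  leaf? : Dec (∃[ i ] i < L × Leaf i)
  leaf? = ℕ.anyUpTo? (λ i → a ℕ.≟ 2 * i ×-dec b ℕ.≟ 2 * i + 1) L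
  cycle? : Dec (∃[ i ] i < L × Cycle i)
  cycle? = ℕ.anyUpTo? (λ i → suc i <? L ×-dec
                              a ℕ.≟ 2 * i + 1 ×-dec b ℕ.≟ 2 * i + 3) L
  close? : Dec (a ≡ 2 * L ∸ 1 × b ≡ 1)
  close? = a ℕ.≟ 2 * L ∸ 1 ×-dec b ℕ.≟ 1
  to : Cases → StackedEdge L a b
  to (inj₁ (i , q , refl , refl))            = leaf i q
  to (inj₂ (inj₁ (i , _ , q , refl , refl))) = cycle i q
  to (inj₂ (inj₂ (refl , refl)))             = close
  from : StackedEdge L a b → Cases
  from (leaf i q)  = inj₁ (i , q , refl , refl)
  from (cycle i q) = inj₂ (inj₁ (i , ℕ.<⇒≤ q , q , refl , refl))
  from close       = inj₂ (inj₂ (refl , refl))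

-- ½ (h/L - 1); exact when L ∣ h and h is odd.
stackedCount : (h L : ℕ) .{{_ : NonZero L}} → ℕ
stackedCount h L = (h / L ∸ 1) / 2

module _ (h L : ℕ) .{{_ : NonZero L}} where

  private
    m = stackedCount h L

  -- inj₁ i is the vertex i of 𝓕; inj₂ (c , i) is the vertex i of the c-th
  -- copy of 𝓣.
  ΓVertex : Set
  ΓVertex = Fin L ⊎ (Fin m × Fin (2 * L))

  data ΓEdge : Rel ΓVertex 0ℓ where
    folded  : ∀ {i j} → FoldedEdge L (toℕ i) (toℕ j) → ΓEdge (inj₁ i) (inj₁ j)
    stacked : ∀ {c i j} → StackedEdge L (toℕ i) (toℕ j) →
              ΓEdge (inj₂ (c , i)) (inj₂ (c , j))

  ΓEdge? : Decidable ΓEdge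
  ΓEdge? (inj₁ i) (inj₁ j) =
    map′ folded (λ { (folded e) → e }) (foldedEdge? L (toℕ i) (toℕ j))
  ΓEdge? (inj₁ _) (inj₂ _) = no λ ()
  ΓEdge? (inj₂ _) (inj₁ _) = no λ ()
  ΓEdge? (inj₂ (c , i)) (inj₂ (d , j)) =
    map′ (λ { (refl , e) → stacked e }) (λ { (stacked e) → refl , e })
      (c Fin.≟ d ×-dec stackedEdge? L (toℕ i) (toℕ j))

  Γvertices : List ΓVertex
  Γvertices = map inj₁ (allFin L) ++ map inj₂ (cartesianProduct (allFin m) (allFin (2 * L)))

  Γcomplete : ∀ v → v ∈ Γvertices
  Γcomplete (inj₁ i) = ∈-++⁺ˡ (∈-map⁺ inj₁ (∈-allFin i))
  Γcomplete (inj₂ (c , i)) =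
    ∈-++⁺ʳ _ (∈-map⁺ inj₂ (∈-cartesianProduct⁺ (∈-allFin c) (∈-allFin i)))

  -- For L ≥ 3 the edge sets contain no loops, so fromEdges discards nothing.
  Γ : FiniteGraph
  Γ = fromEdges ΓVertex (Sum.≡-dec Fin._≟_ (≡-dec Fin._≟_ Fin._≟_))
        Γvertices Γcomplete ΓEdge ΓEdge?

  Floor : ΓVertex → Set
  Floor (inj₁ i)       = toℕ i ≢ 0 × 2 ∣ toℕ i
  Floor (inj₂ (_ , i)) = 2 ∣ toℕ i

  record NewEdge : Set where
    field
      u v      : ΓVertex
      u-floor  : Floor u
      v-floor  : Floor v
      distinct : u ≢ v

  spine : NewEdge → FiniteGraph
  spine e = addEdge Γ u v distinct
    where open NewEdge e

  EdgeAttachment : NewEdge → Set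
  EdgeAttachment e = ¬ Connected Γ u v
    where open NewEdge e

attachBound : (h L : ℕ) → L < h → ℚ
attachBound h L L<h = (+ (h * L + 3 * h + 6 * L)) ℚ./ (2 * (h ∸ L))
  where
  instance
    h∸L≢0 : NonZero (h ∸ L)
    h∸L≢0 = >-nonZero (ℕ.m<n⇒0<n∸m L<h)
    2[h∸L]≢0 : NonZero (2 * (h ∸ L))
    2[h∸L]≢0 = ℕ.m*n≢0 2 (h ∸ L)

nonAttachBound : (h L : ℕ) .{{_ : NonZero L}} → ℚ
nonAttachBound h L = ½ ℚ.* ((+ (L + 3)) ℚ./ 1 ℚ.- (+ (4 * L)) ℚ./ (h + L))
  where
  instance
    h+L≢0 : NonZero (h + L)
    h+L≢0 = >-nonZero (ℕ.<-≤-trans (>-nonZero⁻¹ L) (ℕ.m≤n+m L h))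

{-# OPTIONS --safe #-}

-- Write L = 3 + 2n and h = (1 + 2m)L, so that Γ has m stacked components. Walks along the spine of a
-- component show that diam 𝓕 ≤ n + 2 and diam 𝓣 ≤ n + 3, which bounds the mean diameter when the new
-- edge stays inside a component, since this only shortens distances. Conversely, potential functions
-- show that twice the eccentricity of every floor vertex is at least n + 4 in 𝓕 and 2(n + 3) in 𝓣. If
-- the new edge joins two components, the diameter of their union is at least the sum of the
-- eccentricities of the endpoints plus 1. Hence twice the sum of the m diameters of the spine is at
-- least (n + 4) + 2m(n + 3) + 2, whichever components are joined, and this is exactly attachBound.
module Submission where

open import Defs
open import Data.Fin using (Fin; toℕ)
open import Data.Fin.Properties using (toℕ<n; toℕ-injective; toℕ-fromℕ<)
import Data.Integer as ℤ
import Data.Integer.Properties as ℤ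
import Data.Integer.Tactic.RingSolver as ℤ
open import Data.List
  using (List; []; _∷_; map; deduplicate; length; allFin; cartesianProductWith)
open import Data.List.Extrema.Nat using (v≤max⁺; max≤v⁺)
open import Data.List.Membership.Propositional using (_∈_; lose; find)
open import Data.List.Membership.Propositional.Properties
  using (∈-∃++; ∈-filter⁺; ∈-filter⁻; ∈-cartesianProductWith⁺; ∈-cartesianProductWith⁻;
         ∈-allFin; ∈-map⁺)
open import Data.List.Properties
  using (filter-≐; filter-accept; map-∘; map-cong; length-map; length-tabulate)
open import Data.List.Relation.Binary.Permutation.Propositional
  using (_↭_; ↭-refl; ↭-trans; ↭-sym; prep; ↭⇒↭ₛ)
open import Data.List.Relation.Binary.Permutation.Propositional.Properties
  using (shift; ∈-resp-↭; Any-resp-↭; ↭-length; map⁺)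
open import Data.List.Relation.Binary.Permutation.Setoid.Properties using (AllPairs-resp-↭)
open import Data.List.Relation.Unary.All as All using (All; []; _∷_)
import Data.List.Relation.Unary.All.Properties as All
open import Data.List.Relation.Unary.AllPairs as AllPairs using (AllPairs; []; _∷_)
import Data.List.Relation.Unary.AllPairs.Properties as AllPairs
open import Data.List.Relation.Unary.Any as Any using (Any; here; there)
import Data.List.Relation.Unary.Any.Properties as Any
open import Data.List.Relation.Unary.Unique.DecSetoid.Properties using (deduplicate-!)
open import Data.List.Relation.Unary.Unique.Propositional.Properties using (allFin⁺)
open import Data.Maybe using (Maybe; just; nothing)
open import Data.Maybe.Properties using (just-injective)
open import Data.Nat
open import Data.Nat.Divisibility using (_∣_; divides; m∣m*n)
open import Data.Nat.DivMod using (_mod_; m%n<n; m<n⇒m%n≡m; m*n/n≡m)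
open import Data.Nat.ListAction using (sum)
open import Data.Nat.ListAction.Properties using (sum-↭)
open import Data.Nat.Primality using (Prime)
open import Data.Nat.Properties
open import Data.Nat.Tactic.RingSolver using (solve-∀)
open import Data.Product as Product using (∃-syntax; _×_; _,_; proj₁; proj₂)
open import Data.Rational as ℚ using (ℚ; toℚᵘ; ½)
import Data.Rational.Properties as ℚ
open import Data.Rational.Unnormalised as ℚᵘ using (mkℚᵘ; *≡*; *≤*; *<*)
import Data.Rational.Unnormalised.Properties as ℚᵘ
open import Data.Sum using (_⊎_; inj₁; inj₂)
open import Data.Sum.Properties using (inj₁-injective; inj₂-injective)
open import Function using (_∘_; _⇔_; mk⇔; const; id)
open import Level using (0ℓ)
open import Relation.Binary using (DecSetoid; Symmetric; Transitive; Reflexive)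
open import Relation.Binary.PropositionalEquality
  using (_≡_; _≢_; refl; sym; trans; cong; cong₂; subst; subst₂; setoid; module ≡-Reasoning)
open import Relation.Nullary using (¬_; ¬?; yes; no; contradiction)
open import Relation.Nullary.Decidable using (decidable-stable)

-- Permutations, means and sums of lists

∈⇒↭ : ∀ {A : Set} {x : A} {xs} → x ∈ xs → ∃[ ys ] xs ↭ x ∷ ys
∈⇒↭ x∈xs with ∈-∃++ x∈xs
... | ps , qs , refl = _ , shift _ ps qs

-- Sum and length are invariant under permutation. The explicit `suc k` replaces the case
-- distinction in `mean` by a single quotient.
mean-cong : ∀ {xs ys k} → xs ↭ ys → length ys ≡ suc k →
            mean xs ≡ (ℤ.+ sum ys) ℚ./ suc k
mean-cong {xs} {ys} σ eq with xs | sum-↭ σ | trans (↭-length σ) eq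
... | _ ∷ _ | eqₛ | refl = cong (λ s → (ℤ.+ s) ℚ./ _) eqₛ

sum-map-mono : ∀ {A : Set} {f g : A → ℕ} → (∀ x → f x ≤ g x) →
               ∀ xs → sum (map f xs) ≤ sum (map g xs)
sum-map-mono f≤g []       = z≤n
sum-map-mono f≤g (x ∷ xs) = +-mono-≤ (f≤g x) (sum-map-mono f≤g xs)

sum-map-scale : ∀ {A : Set} c (f : A → ℕ) xs → sum (map (λ x → c * f x) xs) ≡ c * sum (map f xs)
sum-map-scale c f []       = sym (*-zeroʳ c)
sum-map-scale c f (x ∷ xs) =
  trans (cong (c * f x +_) (sum-map-scale c f xs)) (sym (*-distribˡ-+ c (f x) _))

-- Walks, distances and components of a finite graph

module Walks (G : FiniteGraph) where
  open FiniteGraph G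

  infixr 5 _++_
  _++_ : ∀ {i j x y z} → Walk G i x y → Walk G j y z → Walk G (i + j) x z
  []      ++ q = q
  (e ∷ p) ++ q = e ∷ (p ++ q)

  reverse : ∀ {n x y} → Walk G n x y → Walk G n y x
  reverse []                  = []
  reverse {x = x} {y} (_∷_ {n = n} e p) =
    subst (λ k → Walk G k y x) (+-comm n 1) (reverse p ++ (symm e ∷ []))

  Connected-refl : Reflexive (Connected G)
  Connected-refl = 0 , []

  Connected-sym : Symmetric (Connected G)
  Connected-sym (n , p) = n , reverse p

  Connected-trans : Transitive (Connected G)
  Connected-trans (_ , p) (_ , q) = _ , p ++ q

  connectedDecSetoid : DecSetoid 0ℓ 0ℓ
  connectedDecSetoid = record
    { Carrier = Vertex
    ; _≈_     = Connected G
    ; isDecEquivalence = record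
      { isEquivalence = record
        { refl = Connected-refl ; sym = Connected-sym ; trans = Connected-trans }
      ; _≟_ = connected? G
      }
    }

  walk-respects : ∀ {A : Set} (f : Vertex → A) → (∀ {x y} → Adj x y → f x ≡ f y) →
                  ∀ {n x y} → Walk G n x y → f x ≡ f y
  walk-respects f f-adj []      = refl
  walk-respects f f-adj (e ∷ p) = trans (f-adj e) (walk-respects f f-adj p)

  walk-lipschitz : (f : Vertex → ℕ) → (∀ {x y} → Adj x y → f x ≤ suc (f y)) →
                   ∀ {n x y} → Walk G n x y → f x ≤ n + f y
  walk-lipschitz f f-adj []      = ≤-refl
  walk-lipschitz f f-adj (e ∷ p) = ≤-trans (f-adj e) (s≤s (walk-lipschitz f f-adj p))

  dist-walk : ∀ {x y} → Connected G x y → Walk G (dist G x y) x y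
  dist-walk {x} {y} c with connected? G x y
  ... | yes (n , p) = proj₁ (proj₂ (least (λ k → walk? G k x y) n p))
  ... | no ¬c       = contradiction c ¬c

  dist-≤ : ∀ {n x y} → Walk G n x y → dist G x y ≤ n
  dist-≤ {x = x} {y} p with connected? G x y
  ... | yes (n , q) = proj₂ (proj₂ (least (λ k → walk? G k x y) n q)) _ p
  ... | no _        = z≤n

  -- Stronger than `dist G x y ≤ d`, which also holds between different components, where `dist`
  -- takes the default value 0.
  Within : ℕ → Vertex → Vertex → Set
  Within d x y = ∃[ k ] k ≤ d × Walk G k x y

  within-trans : ∀ {d e x y z} → Within d x y → Within e y z → Within (d + e) x z
  within-trans (i , i≤d , p) (j , j≤e , q) = i + j , +-mono-≤ i≤d j≤e , p ++ q

  within-sym : ∀ {d x y} → Within d x y → Within d y x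
  within-sym (i , i≤d , p) = i , i≤d , reverse p

  within-weaken : ∀ {d e x y} → d ≤ e → Within d x y → Within e x y
  within-weaken d≤e (i , i≤d , p) = i , ≤-trans i≤d d≤e , p

  within-adj : ∀ {x y} → Adj x y → Within 1 x y
  within-adj e = 1 , ≤-refl , e ∷ []

  within⇒connected : ∀ {d x y} → Within d x y → Connected G x y
  within⇒connected (i , _ , p) = i , p

  within-path : (s : ℕ → Vertex) → ∀ a d → (∀ {k} → k < a + d → Adj (s k) (s (suc k))) →
                Within d (s a) (s (a + d))
  within-path s a zero    adj = subst (λ b → Within 0 (s a) (s b)) (sym (+-identityʳ a)) (0 , z≤n , [])
  within-path s a (suc d) adj rewrite +-suc a d =
    subst (λ e → Within e (s a) (s (suc (a + d)))) (+-comm d 1)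
      (within-trans (within-path s a d (adj ∘ m<n⇒m<1+n)) (within-adj (adj ≤-refl)))

  -- Both sides filter the same list `vertices` by equivalent predicates, so they agree as lists and
  -- not only as sets.
  component-cong : ∀ {x y} → Connected G x y → component G x ≡ component G y
  component-cong {x} {y} c =
    filter-≐ (connected? G x) (connected? G y)
      (Connected-trans (Connected-sym c) , Connected-trans c) vertices

  dist≤diam : ∀ {r x y} → Connected G r x → Connected G r y →
              dist G x y ≤ diam G (component G r)
  dist≤diam {r} c d = v≤max⁺ 0 _ (inj₂ (lose
    (∈-cartesianProductWith⁺ (dist G) (member c) (member d)) ≤-refl))
    where
    member : ∀ {x} → Connected G r x → x ∈ component G r
    member {x} = ∈-filter⁺ (connected? G r) (complete x)

  diam≤ : ∀ {r b} → (∀ {x y} → Connected G r x → Connected G r y → dist G x y ≤ b) →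
          diam G (component G r) ≤ b
  diam≤ {r} {b} bound = max≤v⁺ z≤n (All.tabulate below)
    where
    connected : ∀ {x} → x ∈ component G r → Connected G r x
    connected = proj₂ ∘ ∈-filter⁻ (connected? G r) {xs = vertices}
    below : ∀ {k} → k ∈ cartesianProductWith (dist G) (component G r) (component G r) → k ≤ b
    below k∈ with ∈-cartesianProductWith⁻ (dist G) (component G r) (component G r) k∈
    ... | _ , _ , x∈ , y∈ , refl = bound (connected x∈) (connected y∈)

  -- Systems of representatives of the components

  record Transversal (R : List Vertex) : Set where
    constructor transversal
    field
      separated : AllPairs (λ x y → ¬ Connected G x y) R
      covering  : ∀ x → Any (Connected G x) R

  deduplicate-transversal : ∀ {vs} → (∀ v → v ∈ vs) → Transversal (deduplicate (connected? G) vs)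
  deduplicate-transversal {vs} all = transversal
    (deduplicate-! connectedDecSetoid vs)
    (λ x → Any.deduplicate⁺ (connected? G) (λ c d → Connected-trans d (Connected-sym c))
             (lose (all x) Connected-refl))

  -- Deduplication keeps the first vertex of each class, so putting `u` and `v` in front of all
  -- vertices retains both.
  transversal∋₂ : ∀ {u v} → ¬ Connected G u v → ∃[ Q ] Transversal (u ∷ v ∷ Q)
  transversal∋₂ {u} {v} ¬c = _ , subst Transversal
    (cong (u ∷_) (filter-accept (¬? ∘ connected? G u) ¬c))
    (deduplicate-transversal {u ∷ v ∷ vertices} (there ∘ there ∘ complete))

  -- Induction on `R`: the head `x` is connected to some `y` in `S`. After both are removed,
  -- separation forces the remaining vertices to be matched among themselves.
  separated-↭ : ∀ {A : Set} (f : Vertex → A) → (∀ {x y} → Connected G x y → f x ≡ f y) →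
    ∀ {R S} → AllPairs (λ x y → ¬ Connected G x y) R → AllPairs (λ x y → ¬ Connected G x y) S →
    (∀ {x} → x ∈ R → Any (Connected G x) S) → (∀ {y} → y ∈ S → Any (Connected G y) R) →
    map f R ↭ map f S
  separated-↭ f f-cong {[]} {[]}    _ _ R⊆S S⊆R = ↭-refl
  separated-↭ f f-cong {[]} {y ∷ S} _ _ R⊆S S⊆R with () ← S⊆R (here refl)
  separated-↭ f f-cong {x ∷ R} {S} (x♯R ∷ R!) S! R⊆S S⊆R
    with y , y∈S , x~y ← find (R⊆S (here refl))
    with S′ , σ ← ∈⇒↭ y∈S
    -- Separation is a symmetric relation, so it survives moving `y` to the front of `S`.
    with y♯S′ ∷ S′! ← AllPairs-resp-↭ (setoid Vertex) (_∘ Connected-sym)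
                        ((λ { refl → λ z → z }) , (λ { refl → λ z → z })) (↭⇒↭ₛ σ) S!
    = ↭-trans (subst (λ z → z ∷ map f R ↭ f y ∷ map f S′) (sym (f-cong x~y))
                (prep (f y) (separated-↭ f f-cong R! S′! R⊆S′ S′⊆R)))
              (↭-sym (map⁺ f σ))
    where
    R⊆S′ : ∀ {z} → z ∈ R → Any (Connected G z) S′
    R⊆S′ z∈R with Any-resp-↭ σ (R⊆S (there z∈R))
    ... | here z~y = contradiction (Connected-trans x~y (Connected-sym z~y)) (All.lookup x♯R z∈R)
    ... | there t  = t
    S′⊆R : ∀ {z} → z ∈ S′ → Any (Connected G z) R
    S′⊆R z∈S′ with S⊆R (∈-resp-↭ (↭-sym σ) (there z∈S′))
    ... | here z~x = contradiction (Connected-sym (Connected-trans z~x x~y)) (All.lookup y♯S′ z∈S′)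
    ... | there t  = t

  transversal-↭ : ∀ {A : Set} (f : Vertex → A) → (∀ {x y} → Connected G x y → f x ≡ f y) →
                  ∀ {R S} → Transversal R → Transversal S → map f R ↭ map f S
  transversal-↭ f f-cong (transversal R! R*) (transversal S! S*) =
    separated-↭ f f-cong R! S! (λ _ → S* _) (λ _ → R* _)

  -- y witnesses that the eccentricity of x is at least half the weight of x.
  Eccentric : (Vertex → ℕ) → Vertex → Set
  Eccentric weight x = ∃[ y ] Connected G x y × (∀ {k} → Walk G k x y → weight x ≤ 2 * k)

  diamAt : Vertex → ℕ
  diamAt = diam G ∘ component G

  -- `diamAt` is constant on components, so the representatives chosen by `components` may be
  -- exchanged for those of any transversal.
  meanDiam-transversal : ∀ {R k} → Transversal R → length R ≡ suc k →
                         meanDiam G ≡ (ℤ.+ sum (map diamAt R)) ℚ./ suc k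
  meanDiam-transversal {R} tr eq = mean-cong
    (subst (_↭ map diamAt R) (map-∘ _)
      (transversal-↭ diamAt (cong (diam G) ∘ component-cong) (deduplicate-transversal complete) tr))
    (trans (length-map diamAt R) eq)

-- Effect of a new edge on distances and components

module AddEdge (G : FiniteGraph) {u v : FiniteGraph.Vertex G} (u≢v : u ≢ v) where
  open FiniteGraph G
  open Walks G
  private
    G⁺ = addEdge G u v u≢v
    module W⁺ = Walks G⁺

  new-edge : FiniteGraph.Adj G⁺ u v
  new-edge = inj₂ (inj₁ (refl , refl))

  embed-walk : ∀ {n x y} → Walk G n x y → Walk G⁺ n x y
  embed-walk []      = []
  embed-walk (e ∷ p) = inj₁ e ∷ embed-walk p

  embed : ∀ {x y} → Connected G x y → Connected G⁺ x y
  embed (n , p) = n , embed-walk p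

  -- A walk that traverses the new edge more than once can be shortened, so it suffices to consider
  -- walks that traverse it at most once.
  data Shortcut (n : ℕ) (x y : Vertex) : Set where
    direct : ∀ {k} → k ≤ n → Walk G k x y → Shortcut n x y
    via    : ∀ {k l} → k + suc l ≤ n → Walk G k x u → Walk G l v y → Shortcut n x y
    via⁻¹  : ∀ {k l} → k + suc l ≤ n → Walk G k x v → Walk G l u y → Shortcut n x y

  tail≤ : ∀ k {l n} → k + suc l ≤ n → l ≤ n
  tail≤ k {l} = ≤-trans (≤-trans (n≤1+n l) (m≤n+m (suc l) k))

  shortcut : ∀ {n x y} → Walk G⁺ n x y → Shortcut n x y
  shortcut []           = direct z≤n []
  shortcut (inj₁ e ∷ p) with shortcut p
  ... | direct k≤ q   = direct (s≤s k≤) (e ∷ q)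
  ... | via   k≤ q r  = via (s≤s k≤) (e ∷ q) r
  ... | via⁻¹ k≤ q r  = via⁻¹ (s≤s k≤) (e ∷ q) r
  shortcut (inj₂ (inj₁ (refl , refl)) ∷ p) with shortcut p
  ... | direct k≤ q           = via (s≤s k≤) [] q
  -- The rest of the walk runs from `v` back to `u` and crosses again; the loop `q` and one crossing
  -- are dropped.
  ... | via   {k} k≤ q r      = via (s≤s (tail≤ k k≤)) [] r
  -- The rest crosses back to `u`, where the walk started, so its final piece `r` alone suffices.
  ... | via⁻¹ {k} k≤ q r      = direct (m≤n⇒m≤1+n (tail≤ k k≤)) r
  shortcut (inj₂ (inj₂ (refl , refl)) ∷ p) with shortcut p
  ... | direct k≤ q           = via⁻¹ (s≤s k≤) [] q
  ... | via⁻¹ {k} k≤ q r      = via⁻¹ (s≤s (tail≤ k k≤)) [] r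
  ... | via   {k} k≤ q r      = direct (m≤n⇒m≤1+n (tail≤ k k≤)) r

  module Within-component (u~v : Connected G u v) where

    -- The endpoints of the new edge are already connected in `G`, so a crossing can be replaced by
    -- a walk in `G`.
    retract : ∀ {x y} → Connected G⁺ x y → Connected G x y
    retract (_ , p) with shortcut p
    ... | direct _ q  = _ , q
    ... | via _ q r   = Connected-trans (_ , q) (Connected-trans u~v (_ , r))
    ... | via⁻¹ _ q r = Connected-trans (_ , q) (Connected-trans (Connected-sym u~v) (_ , r))

    transversal⁺ : ∀ {R} → Transversal R → W⁺.Transversal R
    transversal⁺ (transversal R! R*) =
      W⁺.transversal (AllPairs.map (_∘ retract) R!) (λ x → Any.map embed (R* x))

    -- The graph is a variable H because unification would otherwise evaluate the mean diameter of Γ.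
    meanDiam⁺-≤ : (bound : Vertex → ℕ) →
                  (∀ {r x y} → Connected G r x → Connected G r y → Within (bound r) x y) →
                  ∀ {R k H} → Transversal R → length R ≡ suc k → H ≡ G⁺ →
                  ∃[ s ] s ≤ sum (map bound R) × meanDiam H ≡ (ℤ.+ s) ℚ./ suc k
    meanDiam⁺-≤ bound within {R} tr eq refl =
      sum (map W⁺.diamAt R) , sum-map-mono diamAt⁺-≤ R , W⁺.meanDiam-transversal (transversal⁺ tr) eq
      where
      diamAt⁺-≤ : ∀ r → W⁺.diamAt r ≤ bound r
      diamAt⁺-≤ r = W⁺.diam≤ λ c d →
        let _ , k≤b , p = within (retract c) (retract d) in ≤-trans (W⁺.dist-≤ (embed-walk p)) k≤b

  module Between-components (u≁v : ¬ Connected G u v) where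

    -- The representative `v` is dropped because the new edge puts it in the component of `u`. No
    -- other components merge, since a crossing walk would connect one of its ends to `u` or `v` in
    -- `G`.
    transversal⁺ : ∀ {Q} → Transversal (u ∷ v ∷ Q) → W⁺.Transversal (u ∷ Q)
    transversal⁺ {Q} (transversal ((_ ∷ u♯Q) ∷ v♯Q ∷ Q!) cov) =
      W⁺.transversal (All.tabulate u♯Q⁺ ∷ Q!⁺ Q! u♯Q v♯Q) cov⁺
      where
      u♯Q⁺ : ∀ {q} → q ∈ Q → ¬ Connected G⁺ u q
      u♯Q⁺ q∈Q (_ , p) with shortcut p
      ... | direct _ q  = All.lookup u♯Q q∈Q (_ , q)
      ... | via _ _ r   = All.lookup v♯Q q∈Q (_ , r)
      ... | via⁻¹ _ _ r = All.lookup u♯Q q∈Q (_ , r)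
      sep : ∀ {x y} → ¬ Connected G u x → ¬ Connected G v x → ¬ Connected G x y → ¬ Connected G⁺ x y
      sep u≁x v≁x x≁y (_ , p) with shortcut p
      ... | direct _ q  = x≁y (_ , q)
      ... | via _ q _   = u≁x (Connected-sym (_ , q))
      ... | via⁻¹ _ q _ = v≁x (Connected-sym (_ , q))
      Q!⁺ : ∀ {Q} → AllPairs (λ x y → ¬ Connected G x y) Q → All (¬_ ∘ Connected G u) Q →
            All (¬_ ∘ Connected G v) Q → AllPairs (λ x y → ¬ Connected G⁺ x y) Q
      Q!⁺ []         []          []          = []
      Q!⁺ (x♯ ∷ Q!) (u≁x ∷ u♯) (v≁x ∷ v♯) = All.map (sep u≁x v≁x) x♯ ∷ Q!⁺ Q! u♯ v♯
      cov⁺ : ∀ x → Any (Connected G⁺ x) (u ∷ Q)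
      cov⁺ x with cov x
      ... | here x~u         = here (embed x~u)
      ... | there (here x~v) =
        here (W⁺.Connected-trans (embed x~v) (W⁺.Connected-sym (1 , new-edge ∷ [])))
      ... | there (there q)  = there (Any.map embed q)

    -- The new edge is a bridge: a walk crossing it exactly once, between vertices connected in `G`,
    -- would connect `u` to `v` in `G`.
    dist≤dist⁺ : ∀ {x y} → Connected G x y → dist G x y ≤ dist G⁺ x y
    dist≤dist⁺ x~y with shortcut (W⁺.dist-walk (embed x~y))
    ... | direct k≤ q = ≤-trans (dist-≤ q) k≤
    ... | via _ q r   = contradiction
      (Connected-trans (Connected-sym (_ , q)) (Connected-trans x~y (Connected-sym (_ , r)))) u≁v
    ... | via⁻¹ _ q r = contradiction
      (Connected-trans (_ , r) (Connected-trans (Connected-sym x~y) (_ , q))) u≁v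

    -- After shortening, the walk must cross the bridge from `u` to `v`. It splits into a walk from
    -- `x` to `u`, the bridge, which gives the `suc`, and a walk from `v` to `y`.
    dist-across : ∀ {x y} → Connected G u x → Connected G v y →
                  suc (dist G u x + dist G v y) ≤ dist G⁺ x y
    dist-across {x} {y} u~x v~y
      with shortcut (W⁺.dist-walk {x} {y} (W⁺.Connected-trans (embed (Connected-sym u~x))
                       (W⁺.Connected-trans (1 , new-edge ∷ []) (embed v~y))))
    ... | direct _ q  = contradiction
      (Connected-trans u~x (Connected-trans (_ , q) (Connected-sym v~y))) u≁v
    ... | via {k} {l} k≤ q r = ≤-trans
      (≤-trans (s≤s (+-mono-≤ (dist-≤ (reverse q)) (dist-≤ r))) (≤-reflexive (sym (+-suc k l)))) k≤
    ... | via⁻¹ _ q _ = contradiction (Connected-trans u~x (_ , q)) u≁v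

    diamAt≤diamAt⁺ : ∀ {r x y} → Connected G r x → Connected G x y → dist G x y ≤ W⁺.diamAt r
    diamAt≤diamAt⁺ r~x x~y = ≤-trans (dist≤dist⁺ x~y)
      (W⁺.dist≤diam (embed r~x) (embed (Connected-trans r~x x~y)))

    diamAt⁺-across : ∀ {x y} → Connected G u x → Connected G v y →
                     suc (dist G u x + dist G v y) ≤ W⁺.diamAt u
    diamAt⁺-across u~x v~y = ≤-trans (dist-across u~x v~y)
      (W⁺.dist≤diam (embed u~x) (W⁺.Connected-trans (1 , new-edge ∷ []) (embed v~y)))

    module _ (weight : Vertex → ℕ) (weight-cong : ∀ {x y} → Connected G x y → weight x ≡ weight y)
             (ecc-u : Eccentric weight u) (ecc-v : Eccentric weight v)
             (ecc : ∀ x → ∃[ y ] Connected G x y × Eccentric weight y) where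

      -- The representative `q` need not be eccentric itself, so the bound is taken at an eccentric
      -- vertex `r` of the same component.
      weight≤diamAt⁺ : ∀ q → weight q ≤ 2 * W⁺.diamAt q
      weight≤diamAt⁺ q with ecc q
      ... | r , q~r , z , r~z , far = begin
        weight q          ≡⟨ weight-cong q~r ⟩
        weight r          ≤⟨ far (dist-walk r~z) ⟩
        2 * dist G r z    ≤⟨ *-monoʳ-≤ 2 (diamAt≤diamAt⁺ q~r r~z) ⟩
        2 * W⁺.diamAt q   ∎
        where open ≤-Reasoning

      -- Vertices far from `u` and from `v` on the two sides are joined only through the bridge.
      -- Weights are doubled lengths, so the bridge contributes 2.
      weight+weight≤diamAt⁺ : weight u + weight v + 2 ≤ 2 * W⁺.diamAt u
      weight+weight≤diamAt⁺ = let x , u~x , far-u = ecc-u ; y , v~y , far-v = ecc-v in begin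
        weight u + weight v + 2
          ≤⟨ +-monoˡ-≤ 2 (+-mono-≤ (far-u (dist-walk u~x)) (far-v (dist-walk v~y))) ⟩
        2 * dist G u x + 2 * dist G v y + 2      ≡⟨ factor (dist G u x) (dist G v y) ⟩
        2 * suc (dist G u x + dist G v y)        ≤⟨ *-monoʳ-≤ 2 (diamAt⁺-across u~x v~y) ⟩
        2 * W⁺.diamAt u                          ∎
        where
        open ≤-Reasoning
        factor : ∀ a b → 2 * a + 2 * b + 2 ≡ 2 * suc (a + b)
        factor = solve-∀

      sum-weight≤ : ∀ Q → sum (map weight (u ∷ v ∷ Q)) + 2 ≤ 2 * sum (map W⁺.diamAt (u ∷ Q))
      sum-weight≤ Q = begin
        weight u + (weight v + sum (map weight Q)) + 2
          ≡⟨ regroup (weight u) (weight v) _ ⟩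
        weight u + weight v + 2 + sum (map weight Q)
          ≤⟨ +-mono-≤ weight+weight≤diamAt⁺ (sum-map-mono weight≤diamAt⁺ Q) ⟩
        2 * W⁺.diamAt u + sum (map (λ q → 2 * W⁺.diamAt q) Q)
          ≡⟨ sum-map-scale 2 W⁺.diamAt (u ∷ Q) ⟩
        2 * sum (map W⁺.diamAt (u ∷ Q)) ∎
        where
        open ≤-Reasoning
        regroup : ∀ a b c → a + (b + c) + 2 ≡ a + b + 2 + c
        regroup = solve-∀

      -- Weights are summed over `R`, diameters over a transversal that begins with `u` and `v`. The
      -- two sums of weights agree because `weight` is constant on components.
      meanDiam⁺-≥ : ∀ {R k H} → Transversal R → length R ≡ suc (suc k) → H ≡ G⁺ →
        ∃[ s ] sum (map weight R) + 2 ≤ 2 * s × meanDiam H ≡ (ℤ.+ s) ℚ./ suc k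
      meanDiam⁺-≥ {R} {k} tr eq refl with transversal∋₂ u≁v
      ... | Q , trQ = sum (map W⁺.diamAt (u ∷ Q)) ,
        subst (λ s → s + 2 ≤ 2 * sum (map W⁺.diamAt (u ∷ Q))) (sum-↭ weights) (sum-weight≤ Q) ,
        W⁺.meanDiam-transversal (transversal⁺ trQ) count
        where
        weights : map weight (u ∷ v ∷ Q) ↭ map weight R
        weights = transversal-↭ weight weight-cong trQ tr
        count : suc (length Q) ≡ suc k
        count = suc-injective (trans (sym (length-map weight (u ∷ v ∷ Q)))
          (trans (↭-length weights) (trans (length-map weight R) eq)))

-- Index arithmetic and parity

toℕ-mod : ∀ {i k} .{{_ : NonZero k}} → i < k → toℕ (i mod k) ≡ i
toℕ-mod {i} {k} i<k = trans (toℕ-fromℕ< (m%n<n i k)) (m<n⇒m%n≡m i<k)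

mod-toℕ : ∀ {k} .{{_ : NonZero k}} (i : Fin k) → toℕ i mod k ≡ i
mod-toℕ i = toℕ-injective (toℕ-mod (toℕ<n i))

sum-map-const : ∀ {A : Set} k (xs : List A) → sum (map (const k) xs) ≡ length xs * k
sum-map-const k []       = refl
sum-map-const k (x ∷ xs) = cong (k +_) (sum-map-const k xs)

2k+3≡2[1+k]+1 : ∀ k → 2 * k + 3 ≡ 2 * suc k + 1
2k+3≡2[1+k]+1 = solve-∀

[1+k]*2≡2k+2 : ∀ k → suc k * 2 ≡ 2 * k + 2
[1+k]*2≡2k+2 = solve-∀

2[1+k]∸1≡2k+1 : ∀ k → 2 * suc k ∸ 1 ≡ 2 * k + 1
2[1+k]∸1≡2k+1 k = trans (cong (_∸ 1) (*-suc 2 k)) (+-comm 1 (2 * k))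

[1+n]+[1+n]≡2+2n : ∀ n → suc n + suc n ≡ 2 + 2 * n
[1+n]+[1+n]≡2+2n = solve-∀

even⊎odd : ∀ i → ∃[ k ] (i ≡ 2 * k ⊎ i ≡ 2 * k + 1)
even⊎odd zero    = 0 , inj₁ refl
even⊎odd (suc i) with even⊎odd i
... | k , inj₁ refl = k , inj₂ (+-comm 1 (2 * k))
... | k , inj₂ refl = suc k , inj₁ (2k+2≡ k)
  where
  2k+2≡ : ∀ k → suc (2 * k + 1) ≡ 2 * suc k
  2k+2≡ = solve-∀

-- Potential functions on Γ

-- The 1-Lipschitz condition on an edge, in symmetric form because edges of `Γ` are traversed both
-- ways.
Near : ℕ → ℕ → Set
Near a b = a ≤ suc b × b ≤ suc a

near-sym : ∀ {a b} → Near a b → Near b a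
near-sym (p , q) = q , p

near-suc : ∀ {a b} → Near a b → Near (suc a) (suc b)
near-suc (p , q) = s≤s p , s≤s q

near-1+ : ∀ a → Near a (suc a)
near-1+ a = m≤n⇒m≤1+n (n≤1+n a) , ≤-refl

near-⊓ : ∀ {a b c d} → Near a b → Near c d → Near (a ⊓ c) (b ⊓ d)
near-⊓ (p , q) (r , s) = ⊓-mono-≤ p r , ⊓-mono-≤ q s

near-∸ : ∀ l {a b} → Near a b → Near (l ∸ a) (l ∸ b)
near-∸ l (p , q) = half q , half p
  where
  open ≤-Reasoning
  half : ∀ {x y} → y ≤ suc x → l ∸ x ≤ suc (l ∸ y)
  half {x} {y} y≤ = m≤n+o⇒m∸n≤o l x (begin
    l                 ≤⟨ m≤n+m∸n l y ⟩
    y + (l ∸ y)       ≤⟨ +-monoˡ-≤ (l ∸ y) y≤ ⟩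
    suc x + (l ∸ y)   ≡⟨ +-suc x (l ∸ y) ⟨
    x + suc (l ∸ y)   ∎)

near-∣-∣ : ∀ a j → Near ∣ a - j ∣ ∣ suc a - j ∣
near-∣-∣ zero    zero    = near-1+ 0
near-∣-∣ (suc a) zero    = near-1+ (suc a)
near-∣-∣ zero    (suc j) = near-sym (near-1+ j)
near-∣-∣ (suc a) (suc j) = near-∣-∣ a j

∣m+n-m∣≡n : ∀ m n → ∣ m + n - m ∣ ≡ n
∣m+n-m∣≡n m n = trans (∣-∣-comm (m + n) m) (∣m-m+n∣≡n m n)

cyclicDist : ℕ → ℕ → ℕ → ℕ
cyclicDist l a j = ∣ a - j ∣ ⊓ (l ∸ ∣ a - j ∣)

near-cyclicDist : ∀ l a j → Near (cyclicDist l a j) (cyclicDist l (suc a) j)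
near-cyclicDist l a j = near-⊓ (near-∣-∣ a j) (near-∸ l (near-∣-∣ a j))

-- For `l = j + r` the two arcs to `j` have lengths `r` and `suc j` from position `l`, and `j` and
-- `suc r` from position `0`.
near-cyclicDist-close : ∀ {l j} → j ≤ l → Near (cyclicDist (suc l) l j) (cyclicDist (suc l) 0 j)
near-cyclicDist-close {l} {j} j≤l with r , refl ← m≤n⇒∃[o]m+o≡n j≤l
  rewrite ∣m+n-m∣≡n j r | m+n∸n≡m (suc j) r
        | trans (cong (_∸ j) (sym (+-suc j r))) (m+n∸m≡n j (suc r)) =
  wrap r j , wrap j r
  where
  wrap : ∀ a b → a ⊓ suc b ≤ suc (b ⊓ suc a)
  wrap a b = ⊓-glb (m⊓n≤n a (suc b))
    (≤-trans (m⊓n≤m a (suc b)) (m≤n⇒m≤1+n (n≤1+n a)))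

-- The distance between two leaves whose spine vertices are at distance d; it is 0 for d = 0, where
-- the leaves coincide.
leafDist : ℕ → ℕ
leafDist zero    = 0
leafDist (suc d) = 3 + d

-- Here `suc d` is the distance from the target leaf to a spine vertex. The leaf at that vertex is
-- one step further, or is the target itself if `d` is 0.
near-leafDist : ∀ d → Near (leafDist d) (suc d)
near-leafDist zero    = near-1+ 0
near-leafDist (suc d) = near-sym (near-1+ (2 + d))

leafDist-≥ : ∀ {d k} → suc k ≤ d → 3 + k ≤ leafDist d
leafDist-≥ {suc d} (s≤s k≤d) = s≤s (s≤s (s≤s k≤d))

-- Matches the labels of `𝓣`, where `2 * k` is the leaf attached to the spine vertex `2 * k + 1`.
interleave : (ℕ → ℕ) → (ℕ → ℕ) → ℕ → ℕ
interleave f g 0             = f 0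
interleave f g 1             = g 0
interleave f g (suc (suc i)) = interleave (f ∘ suc) (g ∘ suc) i

interleave-even : ∀ f g k → interleave f g (2 * k) ≡ f k
interleave-even f g zero    = refl
interleave-even f g (suc k) =
  trans (cong (interleave f g) (*-suc 2 k)) (interleave-even (f ∘ suc) (g ∘ suc) k)

interleave-odd : ∀ f g k → interleave f g (2 * k + 1) ≡ g k
interleave-odd f g zero    = refl
interleave-odd f g (suc k) =
  trans (cong (λ i → interleave f g (i + 1)) (*-suc 2 k)) (interleave-odd (f ∘ suc) (g ∘ suc) k)

stacked-near : ∀ l {o e} → (∀ k → Near (e k) (o k)) → (∀ k → Near (o k) (o (suc k))) →
               Near (o l) (o 0) → ∀ {a b} → StackedEdge (suc l) a b →
               Near (interleave e o a) (interleave e o b)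
stacked-near l {o} {e} eo oo o0 (leaf i _)
  rewrite interleave-even e o i | interleave-odd e o i = eo i
stacked-near l {o} {e} eo oo o0 (cycle i _)
  rewrite interleave-odd e o i | 2k+3≡2[1+k]+1 i | interleave-odd e o (suc i) = oo i
stacked-near l {o} {e} eo oo o0 close
  rewrite 2[1+k]∸1≡2k+1 l | interleave-odd e o l = o0

-- In `𝓕` the vertex `2 * k + 2` is the leaf at the spine vertex `2 * k + 1`, and `0` is an
-- additional leaf at `1`, with value `e₀`.
foldedPotential : ℕ → (ℕ → ℕ) → (ℕ → ℕ) → ℕ → ℕ
foldedPotential e₀ o e zero    = e₀
foldedPotential e₀ o e (suc i) = interleave o e i

foldedPotential-odd : ∀ e₀ o e k → foldedPotential e₀ o e (2 * k + 1) ≡ o k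
foldedPotential-odd e₀ o e k rewrite +-comm (2 * k) 1 = interleave-even o e k

foldedPotential-even : ∀ e₀ o e k → foldedPotential e₀ o e (2 * k + 2) ≡ e k
foldedPotential-even e₀ o e k rewrite +-suc (2 * k) 1 = interleave-odd o e k

folded-near : ∀ {l e₀ o e} → Near e₀ (o 0) → (∀ k → Near (o k) (e k)) →
              (∀ k → Near (o k) (o (suc k))) → ∀ {a b} → FoldedEdge l a b →
              Near (foldedPotential e₀ o e a) (foldedPotential e₀ o e b)
folded-near {e₀ = e₀} {o} {e} e₀o oe oo (path (suc k) _ _)
  rewrite foldedPotential-odd e₀ o e (suc k)
        | 2[1+k]∸1≡2k+1 k
        | foldedPotential-odd e₀ o e k = oo k
folded-near {e₀ = e₀} {o} {e} e₀o oe oo (leaf k _)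
  rewrite foldedPotential-odd e₀ o e k | foldedPotential-even e₀ o e k = oe k
folded-near e₀o oe oo base = e₀o

-- Edges and labels of `Γ`

module ΓDistances (h n : ℕ) where

  L last m : ℕ
  L    = 3 + 2 * n
  last = 2 + 2 * n
  m    = stackedCount h L

  𝔾 : FiniteGraph
  𝔾 = Γ h L

  open FiniteGraph 𝔾 using (Vertex; Adj; symm)
  open Walks 𝔾

  -- Reduction modulo `L` allows vertices to be named by natural numbers; bounds enter when a label
  -- is read back by `toℕ-mod`.
  fold : ℕ → Vertex
  fold i = inj₁ (i mod L)

  stack : Fin m → ℕ → Vertex
  stack c i = inj₂ (c , i mod (2 * L))

  fold-toℕ : ∀ i → fold (toℕ i) ≡ inj₁ i
  fold-toℕ i = cong inj₁ (mod-toℕ i)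

  stack-toℕ : ∀ c i → stack c (toℕ i) ≡ inj₂ (c , i)
  stack-toℕ c i = cong (λ j → inj₂ (c , j)) (mod-toℕ i)

  fold-adj : ∀ {a b} → a < b → b < L → FoldedEdge L a b → Adj (fold a) (fold b)
  fold-adj {a} {b} a<b b<L e = distinct , inj₁ (folded (subst₂ (FoldedEdge L) (sym eqa) (sym eqb) e))
    where
    eqa = toℕ-mod (<-trans a<b b<L)
    eqb = toℕ-mod b<L
    distinct : fold a ≢ fold b
    distinct eq = <⇒≢ a<b (trans (sym eqa) (trans (cong toℕ (inj₁-injective eq)) eqb))

  stack-adj : ∀ {c a b} → a ≢ b → a < 2 * L → b < 2 * L → StackedEdge L a b →
              Adj (stack c a) (stack c b)
  stack-adj {c} {a} {b} a≢b a< b< e =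
    distinct , inj₁ (stacked (subst₂ (StackedEdge L) (sym eqa) (sym eqb) e))
    where
    eqa = toℕ-mod a<
    eqb = toℕ-mod b<
    distinct : stack c a ≢ stack c b
    distinct eq = a≢b (trans (sym eqa)
      (trans (cong (toℕ ∘ proj₂) (inj₂-injective eq)) eqb))

  foldSpine : ℕ → Vertex
  foldSpine k = fold (2 * k + 1)

  stackSpine : Fin m → ℕ → Vertex
  stackSpine c k = stack c (2 * k + 1)

  fold-bound : ∀ {k} → k ≤ n → 2 * k + 3 ≤ L
  fold-bound {k} k≤n = subst (2 * k + 3 ≤_) (+-comm (2 * n) 3) (+-monoˡ-≤ 3 (*-monoʳ-≤ 2 k≤n))

  fold-bound⁻¹ : ∀ {k} → 2 * k + 1 < L → k ≤ n
  fold-bound⁻¹ {k} (s≤s p) = s≤s⁻¹ (*-cancelˡ-< 2 k (suc n)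
    (subst₂ _≤_ (+-comm (2 * k) 1) (sym (*-suc 2 n)) p))

  stack-bound : ∀ {k} → k ≤ last → 2 * k + 1 < 2 * L
  stack-bound {k} k≤ = begin-strict
    2 * k + 1         <⟨ +-monoʳ-< (2 * k) (n<1+n 1) ⟩
    2 * k + 2         ≡⟨ trans (+-comm (2 * k) 2) (sym (*-suc 2 k)) ⟩
    2 * suc k         ≤⟨ *-monoʳ-≤ 2 (s≤s k≤) ⟩
    2 * L             ∎
    where open ≤-Reasoning

  foldSpine-adj : ∀ {k} → k < n → Adj (foldSpine k) (foldSpine (suc k))
  foldSpine-adj {k} k<n = fold-adj (+-monoˡ-< 1 (*-monoʳ-< 2 (n<1+n k)))
    (<-≤-trans (+-monoʳ-< (2 * suc k) (s<s z<s)) (fold-bound k<n))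
    (subst (λ a → FoldedEdge L a (2 * suc k + 1))
      (2[1+k]∸1≡2k+1 k)
      (path (suc k) (s≤s z≤n) (fold-bound k<n)))

  foldLeaf-adj : ∀ {k} → k ≤ n → Adj (foldSpine k) (fold (2 * k + 2))
  foldLeaf-adj {k} k≤n = fold-adj (+-monoʳ-< (2 * k) (n<1+n 1))
    (<-≤-trans (+-monoʳ-< (2 * k) (n<1+n 2)) (fold-bound k≤n)) (leaf k (fold-bound k≤n))

  foldBase-adj : Adj (fold 0) (foldSpine 0)
  foldBase-adj = fold-adj z<s (s≤s (s≤s z≤n)) base

  stackLeaf-adj : ∀ {c k} → k ≤ last → Adj (stack c (2 * k)) (stackSpine c k)
  stackLeaf-adj {c} {k} k≤ = stack-adj (<⇒≢ 2k<) (<-trans 2k< (stack-bound k≤)) (stack-bound k≤)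
    (leaf k (s≤s k≤))
    where
    2k< : 2 * k < 2 * k + 1
    2k< = m<m+n (2 * k) z<s

  stackSpine-adj : ∀ {c k} → k < last → Adj (stackSpine c k) (stackSpine c (suc k))
  stackSpine-adj {c} {k} k< = stack-adj (<⇒≢ (+-monoˡ-< 1 (*-monoʳ-< 2 (n<1+n k))))
    (stack-bound (<⇒≤ k<)) (stack-bound k<)
    (subst (StackedEdge L (2 * k + 1)) (2k+3≡2[1+k]+1 k) (cycle k (s≤s k<)))

  stackClose-adj : ∀ {c} → Adj (stackSpine c last) (stackSpine c 0)
  stackClose-adj {c} = stack-adj (λ eq → 1+n≢0 (suc-injective (trans (+-comm 1 (2 * last)) eq)))
    (stack-bound ≤-refl) (stack-bound {0} z≤n)
    (subst (λ a → StackedEdge L a 1)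
      (2[1+k]∸1≡2k+1 last) close)

  -- Upper bounds for the diameters of `𝓕` and `𝓣`

  foldSpine-within : ∀ {a b} → a ≤ b → b ≤ n → Within n (foldSpine a) (foldSpine b)
  foldSpine-within {a} a≤b b≤n with d , refl ← m≤n⇒∃[o]m+o≡n a≤b =
    within-weaken (≤-trans (m≤n+m d a) b≤n)
      (within-path foldSpine a d (λ k< → foldSpine-adj (<-≤-trans k< b≤n)))

  -- The spine of `𝓣` is a cycle of length `3 + 2 * n`, so one of the two arcs between any two
  -- positions has length at most `1 + n`.
  stackSpine-within : ∀ {c a b} → a ≤ b → b ≤ last → Within (1 + n) (stackSpine c a) (stackSpine c b)
  stackSpine-within {c} {a} a≤b b≤ with d , refl ← m≤n⇒∃[o]m+o≡n a≤b with d ≤? 1 + n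
  ... | yes d≤ = within-weaken d≤
    (within-path (stackSpine c) a d (λ k< → stackSpine-adj (<-≤-trans k< b≤)))
  -- The other arc goes down from `a` to `0`, over the closing edge to `last`, and down to `a + d`;
  -- its length is `a + (1 + r)`.
  ... | no d≰ with r , eq ← m≤n⇒∃[o]m+o≡n b≤ = within-weaken (short a r d (≰⇒> d≰) eq)
    (within-trans (within-sym (within-path (stackSpine c) 0 a
        (λ k< → stackSpine-adj (<-≤-trans k< (≤-trans a≤b b≤)))))
      (within-trans (within-sym (within-adj stackClose-adj))
        (within-sym (subst (λ e → Within r (stackSpine c (a + d)) (stackSpine c e)) eq
          (within-path (stackSpine c) (a + d) r
            (λ {k} k< → stackSpine-adj (subst (k <_) eq k<)))))))
    where
    open ≤-Reasoning
    regroup : ∀ a r n → (1 + n) + (a + (1 + r)) ≡ a + (2 + n) + r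
    regroup = solve-∀
    short : ∀ a r d → 2 + n ≤ d → a + d + r ≡ last → a + (1 + r) ≤ 1 + n
    short a r d d≥ eq = +-cancelˡ-≤ (1 + n) _ _ (begin
      (1 + n) + (a + (1 + r)) ≡⟨ regroup a r n ⟩
      a + (2 + n) + r         ≤⟨ +-monoˡ-≤ r (+-monoʳ-≤ a d≥) ⟩
      a + d + r               ≡⟨ eq ⟩
      2 + 2 * n               ≡⟨ [1+n]+[1+n]≡2+2n n ⟨
      (1 + n) + (1 + n)       ∎)

  -- At most one step at each end leads to the spine, which accounts for the 2; `≤-total` puts the
  -- two positions in order.
  near-spine : ∀ {b N} (s : ℕ → Vertex) →
    (∀ {i j} → i ≤ j → j ≤ N → Within b (s i) (s j)) → ∀ {x y i j} → i ≤ N → j ≤ N →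
    Within 1 x (s i) → Within 1 y (s j) → Within (2 + b) x y
  near-spine {b} s spine {i = i} {j} i≤ j≤ x~ y~ =
    within-weaken (≤-reflexive (cong suc (+-comm b 1)))
      (within-trans x~ (within-trans middle (within-sym y~)))
    where
    middle : Within b (s i) (s j)
    middle with ≤-total i j
    ... | inj₁ i≤j = spine i≤j j≤
    ... | inj₂ j≤i = within-sym (spine j≤i i≤)

  fold-anchor : ∀ i → ∃[ k ] k ≤ n × Within 1 (inj₁ i) (foldSpine k)
  fold-anchor i = subst (λ x → ∃[ k ] k ≤ n × Within 1 x (foldSpine k)) (fold-toℕ i)
                    (anchor (toℕ i) (toℕ<n i))
    where
    anchor : ∀ j → j < L → ∃[ k ] k ≤ n × Within 1 (fold j) (foldSpine k)
    anchor zero    _  = 0 , z≤n , within-adj foldBase-adj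
    anchor (suc j) j< with even⊎odd j
    ... | k , inj₁ refl = k , fold-bound⁻¹ (subst (_< L) (+-comm 1 (2 * k)) j<) ,
      subst (λ i → Within 1 (fold i) (foldSpine k)) (+-comm (2 * k) 1) (0 , z≤n , [])
    ... | k , inj₂ refl = k , k≤n ,
      subst (λ i → Within 1 (fold i) (foldSpine k)) (+-suc (2 * k) 1)
        (within-sym (within-adj (foldLeaf-adj k≤n)))
      where k≤n = fold-bound⁻¹ (<-trans (n<1+n _) j<)

  stack-anchor : ∀ c i → ∃[ k ] k ≤ last × Within 1 (inj₂ (c , i)) (stackSpine c k)
  stack-anchor c i = subst (λ x → ∃[ k ] k ≤ last × Within 1 x (stackSpine c k)) (stack-toℕ c i)
                       (anchor (toℕ i) (toℕ<n i))
    where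
    anchor : ∀ j → j < 2 * L → ∃[ k ] k ≤ last × Within 1 (stack c j) (stackSpine c k)
    anchor j j< with even⊎odd j
    ... | k , inj₁ refl = k , k≤ , within-adj (stackLeaf-adj k≤)
      where k≤ = s≤s⁻¹ (*-cancelˡ-< 2 k L j<)
    ... | k , inj₂ refl = k , s≤s⁻¹ (*-cancelˡ-< 2 k L (≤-<-trans (m≤m+n (2 * k) 1) j<)) , 0 , z≤n , []

  fold-within : ∀ i j → Within (2 + n) (inj₁ i) (inj₁ j)
  fold-within i j with fold-anchor i | fold-anchor j
  ... | _ , a≤ , x~ | _ , b≤ , y~ = near-spine foldSpine foldSpine-within a≤ b≤ x~ y~

  stack-within : ∀ c i j → Within (3 + n) (inj₂ (c , i)) (inj₂ (c , j))
  stack-within c i j with stack-anchor c i | stack-anchor c j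
  ... | _ , a≤ , x~ | _ , b≤ , y~ = near-spine (stackSpine c) stackSpine-within a≤ b≤ x~ y~

  -- Components of `Γ` and their representatives

  label : Vertex → Maybe (Fin m)
  label (inj₁ _)       = nothing
  label (inj₂ (c , _)) = just c

  label-adj : ∀ {x y} → Adj x y → label x ≡ label y
  label-adj (_ , inj₁ (folded _))  = refl
  label-adj (_ , inj₁ (stacked _)) = refl
  label-adj (_ , inj₂ (folded _))  = refl
  label-adj (_ , inj₂ (stacked _)) = refl

  connected⇒label : ∀ {x y} → Connected 𝔾 x y → label x ≡ label y
  connected⇒label (_ , p) = walk-respects label label-adj p

  -- With `connected⇒label` this makes `label` a complete invariant of components, so that
  -- connectedness can be decided by matching on constructors.
  label⇒connected : ∀ x y → label x ≡ label y → Connected 𝔾 x y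
  label⇒connected (inj₁ i) (inj₁ j) refl             = within⇒connected (fold-within i j)
  label⇒connected (inj₂ (c , i)) (inj₂ (_ , j)) refl = within⇒connected (stack-within c i j)

  diamBound : Vertex → ℕ
  diamBound (inj₁ _) = 2 + n
  diamBound (inj₂ _) = 3 + n

  connected-within : ∀ {r x y} → Connected 𝔾 r x → Connected 𝔾 r y → Within (diamBound r) x y
  connected-within {r} {x} {y} p q =
    go r x y (connected⇒label p) (connected⇒label q)
    where
    go : ∀ r x y → label r ≡ label x → label r ≡ label y → Within (diamBound r) x y
    go (inj₁ _) (inj₁ i) (inj₁ j) _ _                         = fold-within i j
    go (inj₂ (c , _)) (inj₂ (_ , i)) (inj₂ (_ , j)) refl refl = stack-within c i j

  reps : List Vertex
  reps = fold 2 ∷ map (λ c → stack c 0) (allFin m)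

  reps-transversal : Transversal reps
  reps-transversal = transversal
    (All.map⁺ (All.tabulate (λ _ c → contradiction (connected⇒label c) λ ())) ∷
     AllPairs.map⁺ (AllPairs.map (λ c≢d → c≢d ∘ just-injective ∘ connected⇒label) (allFin⁺ m)))
    covering
    where
    covering : ∀ x → Any (Connected 𝔾 x) reps
    covering (inj₁ i)       = here (label⇒connected _ (fold 2) refl)
    covering (inj₂ (c , i)) = there (lose (∈-map⁺ (λ c → stack c 0) (∈-allFin c))
                                (label⇒connected _ (stack c 0) refl))

  length-reps : length reps ≡ suc m
  length-reps = cong suc (trans (length-map _ (allFin m)) (length-tabulate id))

  -- Twice a lower bound for the eccentricities of the floor vertices; in 𝓕 the extreme
  -- case is a leaf in the middle.
  weight : Vertex → ℕ
  weight (inj₁ _) = 4 + n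
  weight (inj₂ _) = 2 * (3 + n)

  weight-cong : ∀ {x y} → Connected 𝔾 x y → weight x ≡ weight y
  weight-cong {x} {y} c = go x y (connected⇒label c)
    where
    go : ∀ x y → label x ≡ label y → weight x ≡ weight y
    go (inj₁ _) (inj₁ _) _ = refl
    go (inj₂ _) (inj₂ _) _ = refl

  sum-map-reps : ∀ (f : Vertex → ℕ) {a b} → f (fold 2) ≡ a → (∀ c → f (stack c 0) ≡ b) →
                 sum (map f reps) ≡ a + m * b
  sum-map-reps f {a} {b} f≡a f≡b = cong₂ _+_ f≡a (begin
    sum (map f (map (λ c → stack c 0) (allFin m)))  ≡⟨ cong sum (map-∘ (allFin m)) ⟨
    sum (map (λ c → f (stack c 0)) (allFin m))      ≡⟨ cong sum (map-cong f≡b (allFin m)) ⟩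
    sum (map (const b) (allFin m))                  ≡⟨ sum-map-const b (allFin m) ⟩
    length (allFin m) * b                           ≡⟨ cong (_* b) (length-tabulate {n = m} id) ⟩
    m * b                                           ∎)
    where open ≡-Reasoning

  -- Eccentricities of the floor vertices

  potential : (ℕ → ℕ) → (ℕ → ℕ) → Vertex → ℕ
  potential f g (inj₁ i)       = f (toℕ i)
  potential f g (inj₂ (_ , i)) = g (toℕ i)

  -- The potential drops by at most 1 per step, so a walk to one of its zeros is at least as long as
  -- the initial value.
  potential-≤ : ∀ f g → (∀ {a b} → FoldedEdge L a b → Near (f a) (f b)) →
                (∀ {a b} → StackedEdge L a b → Near (g a) (g b)) →
                ∀ {k x y} → potential f g y ≡ 0 → Walk 𝔾 k x y → potential f g x ≤ k
  potential-≤ f g f-near g-near {k} {x} y≡0 p =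
    subst (potential f g x ≤_) (trans (cong (k +_) y≡0) (+-identityʳ k))
      (walk-lipschitz (potential f g) lipschitz p)
    where
    lipschitz : ∀ {x y} → Adj x y → potential f g x ≤ suc (potential f g y)
    lipschitz (_ , inj₁ (folded e))  = proj₁ (f-near e)
    lipschitz (_ , inj₁ (stacked e)) = proj₁ (g-near e)
    lipschitz (_ , inj₂ (folded e))  = proj₂ (f-near e)
    lipschitz (_ , inj₂ (stacked e)) = proj₂ (g-near e)

  -- Leaves in the half away from `0` have `fold 0` as witness; `f` is the distance to it.
  fold-eccentric-base : ∀ i k → toℕ i ≡ 2 * k + 2 → n ≤ 2 * k → Eccentric weight (inj₁ i)
  fold-eccentric-base i k eq n≤2k = fold 0 , c , λ {l} p → (begin
    4 + n                   ≤⟨ +-monoʳ-≤ 4 n≤2k ⟩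
    4 + 2 * k               ≡⟨ *-distribˡ-+ 2 2 k ⟨
    2 * (2 + k)             ≤⟨ *-monoʳ-≤ 2 (far p) ⟩
    2 * l                   ∎)
    where
    open ≤-Reasoning
    c : Connected 𝔾 (inj₁ i) (fold 0)
    c = label⇒connected (inj₁ i) (fold 0) refl
    f : ℕ → ℕ
    f = foldedPotential 0 suc (2 +_)
    far : ∀ {l} → Walk 𝔾 l (inj₁ i) (fold 0) → 2 + k ≤ l
    far {l} p = subst (_≤ l) (trans (cong f eq) (foldedPotential-even 0 suc (2 +_) k))
      (potential-≤ f (const 0) (folded-near (near-1+ 0) (near-1+ ∘ suc) (near-1+ ∘ suc))
        (λ _ → z≤n , z≤n) refl p)

  -- Leaves in the half near `0` have the last leaf of `𝓕` as witness. With `r = n - k - 1` the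
  -- distance to it is `3 + r`, and `2 * k < n` gives `k ≤ r`.
  fold-eccentric-tip : ∀ i k → toℕ i ≡ 2 * k + 2 → 2 * k < n → Eccentric weight (inj₁ i)
  fold-eccentric-tip i k eq 2k<n with r , refl ← m≤n⇒∃[o]m+o≡n (≤-trans (s≤s (m≤n*m k 2)) 2k<n) =
    fold (2 * n′ + 2) , c , λ {l} p → (begin
    4 + (1 + k + r)         ≤⟨ +-monoʳ-≤ 4 (s≤s (+-monoˡ-≤ r k≤r)) ⟩
    4 + (1 + r + r)         ≤⟨ n≤1+n _ ⟩
    5 + (1 + r + r)         ≡⟨ double r ⟩
    2 * (3 + r)             ≤⟨ *-monoʳ-≤ 2 (far p) ⟩
    2 * l                   ∎)
    where
    open ≤-Reasoning
    n′ : ℕ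
    n′ = suc k + r
    double : ∀ r → 5 + (1 + r + r) ≡ 2 * (3 + r)
    double = solve-∀
    k≤r : k ≤ r
    k≤r = +-cancelˡ-≤ k k r (s≤s⁻¹ (subst (λ z → suc (k + z) ≤ suc (k + r)) (+-identityʳ k) 2k<n))
    c : Connected 𝔾 (inj₁ i) (fold (2 * n′ + 2))
    c = label⇒connected (inj₁ i) (fold (2 * n′ + 2)) refl
    o e f : ℕ → ℕ
    o j = suc ∣ j - n′ ∣
    e j = leafDist ∣ j - n′ ∣
    -- The vertex `0` hangs off the first spine vertex, hence one more than `o 0`.
    f   = foldedPotential (suc (o 0)) o e
    tip : toℕ ((2 * n′ + 2) mod L) ≡ 2 * n′ + 2
    tip = toℕ-mod (<-≤-trans (+-monoʳ-< (2 * n′) (n<1+n 2)) (fold-bound ≤-refl))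
    tip≡0 : f (toℕ ((2 * n′ + 2) mod L)) ≡ 0
    tip≡0 = trans (cong f tip) (trans (foldedPotential-even (suc (o 0)) o e n′)
              (cong leafDist (∣n-n∣≡0 n′)))
    value : f (toℕ i) ≡ 3 + r
    value = trans (cong f eq) (trans (foldedPotential-even (suc (o 0)) o e k)
      (cong leafDist (trans (cong ∣ k -_∣ (sym (+-suc k r))) (∣m-m+n∣≡n k (suc r)))))
    far : ∀ {l} → Walk 𝔾 l (inj₁ i) (fold (2 * n′ + 2)) → 3 + r ≤ l
    far {l} p = subst (_≤ l) value
      (potential-≤ f (const 0) (folded-near (near-sym (near-1+ (o 0))) (λ j → near-sym (near-leafDist _))
          (λ j → near-suc (near-∣-∣ j n′)))
        (λ _ → z≤n , z≤n) tip≡0 p)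

  -- In a cycle of length `3 + 2 * n`, index difference `suc n` leaves an arc of length `2 + n` on
  -- the other side, so `j` is at maximal cyclic distance. It is found by moving up from the lower
  -- part and down from the upper part.
  opposite : ∀ a → a ≤ last → ∃[ j ] j ≤ last × ∣ a - j ∣ ≡ suc n
  opposite a a≤ with a ≤? suc n
  ... | yes a≤1+n = a + suc n ,
    ≤-trans (+-monoˡ-≤ (suc n) a≤1+n) (≤-reflexive ([1+n]+[1+n]≡2+2n n)) , ∣m-m+n∣≡n a (suc n)
  ... | no a≰ with j , refl ← m≤n⇒∃[o]m+o≡n (<⇒≤ (≰⇒> a≰)) =
    j , ≤-trans (m≤n+m j (suc n)) a≤ ,
    trans (cong ∣_- j ∣ (+-comm (suc n) j)) (∣m+n-m∣≡n j (suc n))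

  cyclicDist-opposite : ∀ {a j} → ∣ a - j ∣ ≡ suc n → suc n ≤ cyclicDist L a j
  cyclicDist-opposite {a} {j} eq rewrite eq =
    ⊓-glb ≤-refl (m+n≤o⇒m≤o∸n (suc n) (≤-trans (≤-reflexive ([1+n]+[1+n]≡2+2n n)) (n≤1+n (2 + 2 * n))))

  -- The witness is the leaf at the opposite spine vertex: `1 + n` steps around the cycle and two
  -- leaf edges.
  stack-eccentric : ∀ c i a → toℕ i ≡ 2 * a → Eccentric weight (inj₂ (c , i))
  stack-eccentric c i a eq
    with j , j≤ , ∣a-j∣≡ ← opposite a (s≤s⁻¹ (*-cancelˡ-< 2 a L (subst (_< 2 * L) eq (toℕ<n i)))) =
    stack c (2 * j) , conn , λ p → *-monoʳ-≤ 2 (far p)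
    where
    conn : Connected 𝔾 (inj₂ (c , i)) (stack c (2 * j))
    conn = label⇒connected (inj₂ (c , i)) (stack c (2 * j)) refl
    o e g : ℕ → ℕ
    o b = suc (cyclicDist L b j)
    e b = leafDist (cyclicDist L b j)
    g   = interleave e o
    target : toℕ ((2 * j) mod (2 * L)) ≡ 2 * j
    target = toℕ-mod (≤-<-trans (m≤m+n (2 * j) 1) (stack-bound j≤))
    target≡0 : g (toℕ ((2 * j) mod (2 * L))) ≡ 0
    target≡0 = trans (cong g target) (trans (interleave-even e o j)
      (cong (λ d → leafDist (d ⊓ (L ∸ d))) (∣n-n∣≡0 j)))
    value : 3 + n ≤ g (toℕ i)
    value = subst (3 + n ≤_) (sym (trans (cong g eq) (interleave-even e o a)))
      (leafDist-≥ (cyclicDist-opposite {a} {j} ∣a-j∣≡))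
    far : ∀ {l} → Walk 𝔾 l (inj₂ (c , i)) (stack c (2 * j)) → 3 + n ≤ l
    far p = ≤-trans value (potential-≤ (const 0) g (λ _ → z≤n , z≤n)
      (stacked-near last (λ b → near-leafDist (cyclicDist L b j)) (λ b → near-suc (near-cyclicDist L b j))
        (near-suc (near-cyclicDist-close j≤)))
      target≡0 p)

  floor-eccentric : ∀ x → Floor h L x → Eccentric weight x
  floor-eccentric (inj₁ i) (i≢0 , divides zero eq) = contradiction eq i≢0
  floor-eccentric (inj₁ i) (i≢0 , divides (suc k) eq) with n ≤? 2 * k
  ... | yes n≤2k = fold-eccentric-base i k (trans eq ([1+k]*2≡2k+2 k)) n≤2k
  ... | no n≰2k  = fold-eccentric-tip i k (trans eq ([1+k]*2≡2k+2 k)) (≰⇒> n≰2k)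
  floor-eccentric (inj₂ (c , i)) (divides a eq) = stack-eccentric c i a (trans eq (*-comm a 2))

  connected-floor : ∀ x → ∃[ y ] Connected 𝔾 x y × Floor h L y
  connected-floor (inj₁ i) = fold 2 , label⇒connected (inj₁ i) (fold 2) refl ,
    subst (λ k → k ≢ 0 × 2 ∣ k) (sym (toℕ-mod {2} {L} (s≤s (s≤s (s≤s z≤n)))))
      ((λ ()) , divides 1 refl)
  connected-floor (inj₂ (c , i)) = stack c 0 , label⇒connected (inj₂ (c , i)) (stack c 0) refl ,
    subst (2 ∣_) (sym (toℕ-mod {0} {2 * L} z<s)) (divides 0 refl)

  module _ (new : NewEdge h L) {H : FiniteGraph} (H≡ : H ≡ spine h L new) where
    open NewEdge new
    open AddEdge 𝔾 distinct

    -- Two of the `suc m` components merge, so the mean is taken over `m`, here `suc k`, components.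
    attached-meanDiam : EdgeAttachment h L new → ∀ {k} → m ≡ suc k → ∃[ s ]
      4 + n + m * (2 * (3 + n)) + 2 ≤ 2 * s × meanDiam H ≡ (ℤ.+ s) ℚ./ suc k
    attached-meanDiam u≁v {k} m≡1+k =
      Product.map₂ (λ {s} → Product.map₁
          (subst (λ w → w + 2 ≤ 2 * s) (sum-map-reps weight refl (λ _ → refl))))
        (Between-components.meanDiam⁺-≥ u≁v weight weight-cong
          (floor-eccentric u u-floor) (floor-eccentric v v-floor)
          (λ x → Product.map₂ (Product.map₂ (floor-eccentric _)) (connected-floor x))
          {reps} {k} {H} reps-transversal (trans length-reps (cong suc m≡1+k)) H≡)

    unattached-meanDiam : ¬ EdgeAttachment h L new → ∃[ s ]
      s ≤ 2 + n + m * (3 + n) × meanDiam H ≡ (ℤ.+ s) ℚ./ suc m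
    unattached-meanDiam ¬u≁v =
      Product.map₂ (λ {s} → Product.map₁ (subst (s ≤_) (sum-map-reps diamBound refl (λ _ → refl))))
        -- Absence of attachment is a double negation of connectedness, which decidability removes.
        (Within-component.meanDiam⁺-≤ (decidable-stable (connected? 𝔾 u v) ¬u≁v) diamBound
          connected-within {reps} {m} {H} reps-transversal length-reps H≡)

-- Rational arithmetic for the two bounds

toℚᵘ-/ : ∀ i d → toℚᵘ (i ℚ./ suc d) ℚᵘ.≃ mkℚᵘ i d
toℚᵘ-/ i d = ℚ.toℚᵘ-fromℚᵘ (mkℚᵘ i d)

/-mono-≤ : ∀ a b c d .{{_ : NonZero b}} .{{_ : NonZero d}} → a * d ≤ c * b →
           (ℤ.+ a) ℚ./ b ℚ.≤ (ℤ.+ c) ℚ./ d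
/-mono-≤ a (suc b) c (suc d) le = ℚ.toℚᵘ-cancel-≤
  (ℚᵘ.≤-respˡ-≃ (ℚᵘ.≃-sym (toℚᵘ-/ (ℤ.+ a) b)) (ℚᵘ.≤-respʳ-≃ (ℚᵘ.≃-sym (toℚᵘ-/ (ℤ.+ c) d))
    (*≤* (subst₂ ℤ._≤_ (ℤ.pos-* a (suc d)) (ℤ.pos-* c (suc b)) (ℤ.+≤+ le)))))

/-mono-< : ∀ a b c d .{{_ : NonZero b}} .{{_ : NonZero d}} → a * d < c * b →
           (ℤ.+ a) ℚ./ b ℚ.< (ℤ.+ c) ℚ./ d
/-mono-< a (suc b) c (suc d) lt = ℚ.toℚᵘ-cancel-<
  (ℚᵘ.<-respˡ-≃ (ℚᵘ.≃-sym (toℚᵘ-/ (ℤ.+ a) b)) (ℚᵘ.<-respʳ-≃ (ℚᵘ.≃-sym (toℚᵘ-/ (ℤ.+ c) d))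
    (*<* (subst₂ ℤ._<_ (ℤ.pos-* a (suc d)) (ℤ.pos-* c (suc b)) (ℤ.+<+ lt)))))

/-cross : ∀ a b c d .{{_ : NonZero b}} .{{_ : NonZero d}} → a * d ≡ c * b →
          (ℤ.+ a) ℚ./ b ≡ (ℤ.+ c) ℚ./ d
/-cross a b c d eq = ℚ.≤-antisym (/-mono-≤ a b c d (≤-reflexive eq)) (/-mono-≤ c d a b (≤-reflexive (sym eq)))

-- The shape of `nonAttachBound` once its fractions are reduced; the denominator is `suc m`. The
-- numerator is `a * suc m - 1`, expressed through `suc N` to avoid truncated subtraction.
½*[2a-2/m] : ∀ a m N → suc N ≡ a * suc m →
             ½ ℚ.* ((ℤ.+ (2 * a)) ℚ./ 1 ℚ.- (ℤ.+ 2) ℚ./ suc m) ≡ (ℤ.+ N) ℚ./ suc m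
½*[2a-2/m] a m N 1+N≡ = ℚ.toℚᵘ-injective (begin-equality
  toℚᵘ (½ ℚ.* (p ℚ.- q))
    ≃⟨ ℚ.toℚᵘ-homo-* ½ (p ℚ.- q) ⟩
  toℚᵘ ½ ℚᵘ.* toℚᵘ (p ℚ.- q)
    ≃⟨ ℚᵘ.*-congˡ {toℚᵘ ½} (ℚ.toℚᵘ-homo-+ p (ℚ.- q)) ⟩
  toℚᵘ ½ ℚᵘ.* (toℚᵘ p ℚᵘ.+ toℚᵘ (ℚ.- q))
    ≃⟨ ℚᵘ.*-congˡ {toℚᵘ ½} (ℚᵘ.+-cong (toℚᵘ-/ (ℤ.+ (2 * a)) 0)
         (ℚᵘ.≃-trans (ℚ.toℚᵘ-homo‿- q) (ℚᵘ.-‿cong (toℚᵘ-/ (ℤ.+ 2) m)))) ⟩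
  toℚᵘ ½ ℚᵘ.* (mkℚᵘ (ℤ.+ (2 * a)) 0 ℚᵘ.- mkℚᵘ (ℤ.+ 2) m)
    ≃⟨ *≡* cross ⟩
  mkℚᵘ (ℤ.+ N) m
    ≃⟨ toℚᵘ-/ (ℤ.+ N) m ⟨
  toℚᵘ ((ℤ.+ N) ℚ./ suc m) ∎)
  where
  open ℚᵘ.≤-Reasoning
  p = (ℤ.+ (2 * a)) ℚ./ 1
  q = (ℤ.+ 2) ℚ./ suc m
  M = ℤ.+ suc m
  N≡ : ℤ.+ N ≡ ℤ.+ a ℤ.* M ℤ.- ℤ.1ℤ
  N≡ = trans (unsuc (ℤ.+ N)) (cong (ℤ._- ℤ.1ℤ) (trans (cong ℤ.+_ 1+N≡) (ℤ.pos-* a (suc m))))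
    where
    unsuc : ∀ x → x ≡ (ℤ.1ℤ ℤ.+ x) ℤ.- ℤ.1ℤ
    unsuc = ℤ.solve-∀
  ring : ∀ x y → (ℤ.1ℤ ℤ.* ((ℤ.+ 2 ℤ.* x) ℤ.* y ℤ.+ (ℤ.- ℤ.+ 2) ℤ.* ℤ.1ℤ)) ℤ.* y
                 ≡ (x ℤ.* y ℤ.- ℤ.1ℤ) ℤ.* (ℤ.+ 2 ℤ.* y)
  ring = ℤ.solve-∀
  cross : (ℤ.1ℤ ℤ.* (ℤ.+ (2 * a) ℤ.* M ℤ.+ (ℤ.- ℤ.+ 2) ℤ.* ℤ.1ℤ)) ℤ.* M
          ≡ ℤ.+ N ℤ.* ℤ.+ (2 * (1 * suc m))
  cross = trans
    (cong (λ x → (ℤ.1ℤ ℤ.* (x ℤ.* M ℤ.+ (ℤ.- ℤ.+ 2) ℤ.* ℤ.1ℤ)) ℤ.* M) (ℤ.pos-* 2 a))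
    (trans (ring (ℤ.+ a) M) (sym (cong₂ ℤ._*_ N≡
      (trans (cong (λ d → ℤ.+ (2 * d)) (*-identityˡ (suc m))) (ℤ.pos-* 2 (suc m))))))

module Bounds (n m : ℕ) where

  private
    L h N S : ℕ
    L = 3 + 2 * n
    h = (1 + 2 * m) * L
    N = 2 + n + m * (3 + n)
    S = 4 + n + m * (2 * (3 + n)) + 2

  h∸L≡ : h ∸ L ≡ 2 * m * L
  h∸L≡ = m+n∸m≡n L (2 * m * L)

  nonZero-2[h∸L] : L < h → NonZero (2 * (h ∸ L))
  nonZero-2[h∸L] L<h = m*n≢0 2 (h ∸ L) {{_}} {{>-nonZero (m<n⇒0<n∸m L<h)}}

  -- The identity `factor` is the cross-multiplied form of `attachBound` being `S / (2 * m)`, so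
  -- halving the bound on `2 * s` loses nothing.
  attachBound-≤ : ∀ {k s} (L<h : L < h) → m ≡ suc k → S ≤ 2 * s →
                  attachBound h L L<h ℚ.≤ (ℤ.+ s) ℚ./ suc k
  attachBound-≤ {k} {s} L<h m≡ s≥ =
    /-mono-≤ (h * L + 3 * h + 6 * L) (2 * (h ∸ L)) s (suc k) {{nonZero-2[h∸L] L<h}} (begin
      (h * L + 3 * h + 6 * L) * suc k                ≡⟨ cong ((h * L + 3 * h + 6 * L) *_) m≡ ⟨
      (h * L + 3 * h + 6 * L) * m                    ≡⟨ factor n m ⟩
      S * (2 * m * L)                                ≤⟨ *-monoˡ-≤ (2 * m * L) s≥ ⟩
      2 * s * (2 * m * L)                            ≡⟨ regroup s (2 * m * L) ⟩
      s * (2 * (2 * m * L))                          ≡⟨ cong (λ d → s * (2 * d)) h∸L≡ ⟨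
      s * (2 * (h ∸ L))                              ∎)
    where
    open ≤-Reasoning
    regroup : ∀ a b → 2 * a * b ≡ a * (2 * b)
    regroup = solve-∀
    factor : ∀ n m →
      ((1 + 2 * m) * (3 + 2 * n) * (3 + 2 * n) + 3 * ((1 + 2 * m) * (3 + 2 * n)) + 6 * (3 + 2 * n)) * m
      ≡ (4 + n + m * (2 * (3 + n)) + 2) * (2 * m * (3 + 2 * n))
    factor = solve-∀

  -- Here `L + 3 = 2 * (3 + n)` and `h + L = 2 * suc m * L`, so the subtracted fraction reduces to
  -- `2 / suc m`.
  nonAttachBound≡ : nonAttachBound h L ≡ (ℤ.+ N) ℚ./ suc m
  nonAttachBound≡ = trans
    (cong (½ ℚ.*_) (cong₂ ℚ._-_ (cong (λ a → (ℤ.+ a) ℚ./ 1) (L+3≡ n))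
      (/-cross (4 * L) (h + L) 2 (suc m) (cross n m))))
    -- `suc N` unfolds to `suc m * (3 + n)`.
    (½*[2a-2/m] (3 + n) m N (*-comm (suc m) (3 + n)))
    where
    L+3≡ : ∀ n → 3 + 2 * n + 3 ≡ 2 * (3 + n)
    L+3≡ = solve-∀
    cross : ∀ n m → 4 * (3 + 2 * n) * suc m ≡ 2 * ((1 + 2 * m) * (3 + 2 * n) + (3 + 2 * n))
    cross = solve-∀

  ≤-nonAttachBound : ∀ {s} → s ≤ N → (ℤ.+ s) ℚ./ suc m ℚ.≤ nonAttachBound h L
  ≤-nonAttachBound {s} s≤ = subst ((ℤ.+ s) ℚ./ suc m ℚ.≤_) (sym nonAttachBound≡)
    (/-mono-≤ s (suc m) N (suc m) (*-monoˡ-≤ (suc m) s≤))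

  nonAttachBound<attachBound : (L<h : L < h) → nonAttachBound h L ℚ.< attachBound h L L<h
  nonAttachBound<attachBound L<h = subst (ℚ._< attachBound h L L<h) (sym nonAttachBound≡)
    (/-mono-< N (suc m) (h * L + 3 * h + 6 * L) (2 * (h ∸ L)) {{_}} {{nonZero-2[h∸L] L<h}} (begin-strict
      N * (2 * (h ∸ L))                                            ≡⟨ cong (λ d → N * (2 * d)) h∸L≡ ⟩
      -- The difference of the two cross products is the added term, which is visibly positive.
      N * (2 * (2 * m * L))                                        <⟨ m<m+n _ z<s ⟩
      N * (2 * (2 * m * L)) + 2 * L * (suc m * (6 + n) + 2 * m)    ≡⟨ difference n m ⟩
      (h * L + 3 * h + 6 * L) * suc m                              ∎))
    where
    open ≤-Reasoning
    difference : ∀ n m →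
      (2 + n + m * (3 + n)) * (2 * (2 * m * (3 + 2 * n))) + 2 * (3 + 2 * n) * (suc m * (6 + n) + 2 * m)
      ≡ ((1 + 2 * m) * (3 + 2 * n) * (3 + 2 * n) + 3 * ((1 + 2 * m) * (3 + 2 * n)) + 6 * (3 + 2 * n)) * suc m
    difference = solve-∀

-- Parametrisation of `L` and `h`, and the bounds for the spine

odd≥3 : ∀ {L} → ¬ 2 ∣ L → 3 ≤ L → ∃[ n ] L ≡ 3 + 2 * n
odd≥3 {L} 2∤L 3≤L with even⊎odd L
... | k     , inj₁ refl = contradiction (m∣m*n k) 2∤L
... | zero  , inj₂ refl = contradiction 3≤L λ { (s≤s ()) }
... | suc k , inj₂ refl = k , trans (cong (_+ 1) (*-suc 2 k)) (cong (2 +_) (+-comm (2 * k) 1))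

-- As `h` is odd, the quotient `h / L` is odd too, so the halving in `stackedCount` is exact.
odd-multiple : ∀ {h L} .{{_ : NonZero L}} → ¬ 2 ∣ h → L ∣ h → h ≡ (1 + 2 * stackedCount h L) * L
odd-multiple {L = L} 2∤h (divides q refl) with even⊎odd q
... | k , inj₁ refl = contradiction (divides (k * L) (rotate k L)) 2∤h
  where
  rotate : ∀ k l → 2 * k * l ≡ k * l * 2
  rotate = solve-∀
... | k , inj₂ refl = cong (_* L) (trans (+-comm (2 * k) 1) (cong (λ m → 1 + 2 * m) (sym count)))
  where
  count : stackedCount ((2 * k + 1) * L) L ≡ k
  count = trans (cong (λ q → (q ∸ 1) / 2) (m*n/n≡m (2 * k + 1) L))
    (trans (cong (_/ 2) (trans (m+n∸n≡m (2 * k) 1) (*-comm 2 k))) (m*n/n≡m k 2))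

-- With `m` a free variable the equation for `h` can be matched with `refl`. For
-- `m = stackedCount h L` this is impossible, since `h` occurs on both sides.
attachBound-≤ : ∀ {h n m k s} → h ≡ (1 + 2 * m) * (3 + 2 * n) → m ≡ suc k → (L<h : 3 + 2 * n < h) →
  4 + n + m * (2 * (3 + n)) + 2 ≤ 2 * s → attachBound h (3 + 2 * n) L<h ℚ.≤ (ℤ.+ s) ℚ./ suc k
attachBound-≤ {n = n} {m} {k} {s} refl m≡ L<h = Bounds.attachBound-≤ n m {k} {s} L<h m≡

≤-nonAttachBound : ∀ {h n m s} → h ≡ (1 + 2 * m) * (3 + 2 * n) → s ≤ 2 + n + m * (3 + n) →
                   (ℤ.+ s) ℚ./ suc m ℚ.≤ nonAttachBound h (3 + 2 * n)
≤-nonAttachBound {n = n} {m} refl = Bounds.≤-nonAttachBound n m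

gap : ∀ {h n m} → h ≡ (1 + 2 * m) * (3 + 2 * n) → (L<h : 3 + 2 * n < h) →
      nonAttachBound h (3 + 2 * n) ℚ.< attachBound h (3 + 2 * n) L<h
gap {n = n} {m} refl = Bounds.nonAttachBound<attachBound n m

positive-multiple : ∀ {h m L} → h ≡ (1 + 2 * m) * L → L < h → ∃[ k ] m ≡ suc k
positive-multiple {m = zero}  refl L<h = contradiction (sym (*-identityˡ _)) (<⇒≢ L<h)
positive-multiple {m = suc k} _    _   = k , refl

module _ {h L : ℕ} .{{_ : NonZero L}} (h≡ : h ≡ (1 + 2 * stackedCount h L) * L) (L<h : L < h) where

  nonAttachBound<attachBound : ∃[ n ] L ≡ 3 + 2 * n → nonAttachBound h L ℚ.< attachBound h L L<h
  nonAttachBound<attachBound (n , refl) = gap {h} {n} {stackedCount h (3 + 2 * n)} h≡ L<h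

  module _ (e : NewEdge h L) {H : FiniteGraph} (H≡ : H ≡ spine h L e) where

    attached-≥ : ∃[ n ] L ≡ 3 + 2 * n → EdgeAttachment h L e → attachBound h L L<h ℚ.≤ meanDiam H
    attached-≥ (n , refl) att =
      let k , m≡      = positive-multiple h≡ L<h
          s , s≥ , eq = ΓDistances.attached-meanDiam h n e {H} H≡ att m≡
      in subst (attachBound h L L<h ℚ.≤_) (sym eq)
           (attachBound-≤ {h} {n} {stackedCount h L} {k} {s} h≡ m≡ L<h s≥)

    unattached-≤ : ∃[ n ] L ≡ 3 + 2 * n → ¬ EdgeAttachment h L e → meanDiam H ℚ.≤ nonAttachBound h L
    unattached-≤ (n , refl) ¬att =
      let s , s≤ , eq = ΓDistances.unattached-meanDiam h n e {H} H≡ ¬att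
      in subst (ℚ._≤ nonAttachBound h L) (sym eq)
           (≤-nonAttachBound {h} {n} {stackedCount h L} {s} h≡ s≤)

mainTheorem15 : (p : ℕ) → Prime p → (p % 120 ≡ 71 ⊎ p % 120 ≡ 119) →
    (h : ℕ) → IsClassNumber p h → ¬ (2 ∣ h) →
    (𝔭 : Ideal p) → IsPrimeAbove2 p 𝔭 →
    (L : ℕ) .{{_ : NonZero L}} → IsClassOrder p 𝔭 L → ¬ (2 ∣ L) → 3 ≤ L → L ∣ h →
    (L<h : L < h) →
    attachBound h L L<h ℚ.> nonAttachBound h L
    × ((e : NewEdge h L) → EdgeAttachment h L e →
    meanDiam (spine h L e) ℚ.≥ attachBound h L L<h)
    × ((e : NewEdge h L) → ¬ EdgeAttachment h L e →
    meanDiam (spine h L e) ℚ.≤ nonAttachBound h L)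
    × ((e e′ : NewEdge h L) → meanDiam (spine h L e) ≡ meanDiam (spine h L e′) →
    EdgeAttachment h L e ⇔ EdgeAttachment h L e′)
mainTheorem15 p _ _ h _ 2∤h 𝔭 _ L _ 2∤L 3≤L L∣h L<h =
  bounds , attached , unattached , λ e e′ eq → mk⇔ (transfer e e′ eq) (transfer e′ e (sym eq))
  where
  L≡ = odd≥3 2∤L 3≤L
  h≡ = odd-multiple 2∤h L∣h
  bounds : nonAttachBound h L ℚ.< attachBound h L L<h
  bounds = nonAttachBound<attachBound h≡ L<h L≡
  attached : (e : NewEdge h L) → EdgeAttachment h L e → meanDiam (spine h L e) ℚ.≥ attachBound h L L<h
  attached e = attached-≥ h≡ L<h e {spine h L e} refl L≡
  unattached : (e : NewEdge h L) → ¬ EdgeAttachment h L e → meanDiam (spine h L e) ℚ.≤ nonAttachBound h L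
  unattached e = unattached-≤ h≡ L<h e {spine h L e} refl L≡
  transfer : ∀ e e′ → meanDiam (spine h L e) ≡ meanDiam (spine h L e′) →
             EdgeAttachment h L e → EdgeAttachment h L e′
  -- If `e` attached while the endpoints of `e′` were connected, the two equal means would lie on
  -- opposite sides of the gap between the bounds.
  transfer e e′ eq att u~v = ℚ.<-irrefl {meanDiam (spine h L e′)} {meanDiam (spine h L e)} (sym eq)
    (ℚ.≤-<-trans (unattached e′ (λ ¬u~v → ¬u~v u~v)) (ℚ.<-≤-trans bounds (attached e att)))
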